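{- The function $\Phi:\mathbb{C}\to\mathbb{C}$, $\Phi(n)=\frac{1}{\phi^{n-1}}$ (the principal nFe-sequence), is a complex complete nFe-sequence, and it equals $\Omega_{1,1}$, that is, \[\Omega_{1,1}(n)=\Phi(n)\quad\text{for all } n\in\mathbb{C}.\]
   Context: $\phi=\frac{1+\sqrt5}{2}$. For complex $n$, $(-1)^n:=\exp(i\pi n)$, $\phi^n:=\exp(n\log\phi)$ with the real logarithm of $\phi$, and $(-\phi)^n:=(-1)^n\cdot\phi^n$. The function $\Theta:\mathbb{C}\to\mathbb{C}$ is $\Theta(n)=\frac{\phi^n-(-\phi)^{ -n}}{\sqrt5}$. For $\eta,\gamma\in\mathbb{C}$, $\Omega_{\eta,\gamma}:\mathbb{C}\to\mathbb{C}$ is defined by $\Omega_{\eta,\gamma}(n)=\eta\cdot(-1)^{n-1}\cdot\Theta(n)+\gamma\cdot(-1)^{n}\cdot\Theta(n-1)\cdot\phi$. A function $\tilde\omega:\mathbb{C}\to\mathbb{C}$ is called a complex complete nFe-sequence (negaFibonacci-esque sequence) if $\tilde\omega(n)=\tilde\omega(n-2)-\tilde\omega(n-1)$ for all $n\in\mathbb{C}$. -}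

module Defs where

open import Data.Empty using (⊥-elim)
open import Data.Integer.Base as ℤ using (ℤ; +_)
import Data.Integer.Properties as ℤₚ
open import Data.Nat.Base as ℕ using (ℕ; zero; suc)
import Data.Nat.Coprimality as Coprimality
import Data.Nat.Properties as ℕₚ
import Data.Nat.Solver as ℕSolver
open import Data.Product.Base using (∃-syntax; _×_; _,_; proj₁; proj₂)
open import Data.Rational.Base
open import Data.Rational.Properties
open import Data.Rational.Solver using (module +-*-Solver)
import Data.Rational.Unnormalised.Base as ℚᵘ
import Data.Rational.Unnormalised.Properties as ℚᵘₚ
open import Data.Sum.Base using (inj₁; inj₂)
open import Relation.Binary.PropositionalEquality using (_≡_; refl; sym; trans; cong; cong₂; subst; subst₂)
open import Relation.Nullary using (¬_; yes; no)

private
  module ℚR = ≤-Reasoning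

fromℕ : ℕ → ℚ
fromℕ n = mkℚ (+ n) 0 (Coprimality.sym (Coprimality.1-coprimeTo n))

module ℚ-Lemmas where
  fromℕ-+ : ∀ m n → fromℕ (m ℕ.+ n) ≡ fromℕ m + fromℕ n
  fromℕ-+ m n = toℚᵘ-injective (ℚᵘₚ.≃-trans
    (ℚᵘ.*≡* (cong (ℤ._* (+ 1)) (sym (cong₂ ℤ._+_ (ℤₚ.*-identityʳ (+ m)) (ℤₚ.*-identityʳ (+ n))))))
    (ℚᵘₚ.≃-sym (toℚᵘ-homo-+ (fromℕ m) (fromℕ n))))

  fromℕ-* : ∀ m n → fromℕ (m ℕ.* n) ≡ fromℕ m * fromℕ n
  fromℕ-* m n = toℚᵘ-injective (ℚᵘₚ.≃-trans
    (ℚᵘ.*≡* (cong (ℤ._* (+ 1)) (ℤₚ.pos-* m n)))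
    (ℚᵘₚ.≃-sym (toℚᵘ-homo-* (fromℕ m) (fromℕ n))))

  fromℕ-mono : ∀ {m n} → m ℕ.≤ n → fromℕ m ≤ fromℕ n
  fromℕ-mono m≤n = *≤* (ℤₚ.*-monoʳ-≤-nonNeg (+ 1) (ℤ.+≤+ m≤n))

  0≤fromℕ : ∀ n → 0ℚ ≤ fromℕ n
  0≤fromℕ n = fromℕ-mono {0} ℕ.z≤n

  archimedean : ∀ q → ∃[ n ] q ≤ fromℕ n
  archimedean q@(mkℚ a d _) = ℤ.∣ a ∣ , *≤* (begin
    a ℤ.* (+ 1)            ≡⟨ ℤₚ.*-identityʳ a ⟩
    a                      ≤⟨ i≤∣i∣ a ⟩
    + ℤ.∣ a ∣              ≤⟨ ℤ.+≤+ (ℕₚ.m≤m*n ℤ.∣ a ∣ (suc d)) ⟩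
    + (ℤ.∣ a ∣ ℕ.* suc d)  ≡⟨ ℤₚ.pos-* ℤ.∣ a ∣ (suc d) ⟩
    + ℤ.∣ a ∣ ℤ.* + suc d  ∎)
    where
    open ℤₚ.≤-Reasoning
    i≤∣i∣ : ∀ i → i ℤ.≤ + ℤ.∣ i ∣
    i≤∣i∣ (+ n)       = ℤₚ.≤-refl
    i≤∣i∣ (ℤ.-[1+ n ]) = ℤ.-≤+

  0≤1 : 0ℚ ≤ 1ℚ
  0≤1 = <⇒≤ (positive⁻¹ 1ℚ)

  0<½* : ∀ {ε} → 0ℚ < ε → 0ℚ < ½ * ε
  0<½* {ε} h = positive⁻¹ (½ * ε) {{pos*pos⇒pos ½ ε {{positive h}}}}

  halves : ∀ ε → ½ * ε + ½ * ε ≡ ε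
  halves ε = trans (sym (*-distribʳ-+ ε ½ ½)) (*-identityˡ ε)

  monoˡ : ∀ {r p q} → 0ℚ ≤ r → p ≤ q → r * p ≤ r * q
  monoˡ {r} h = *-monoˡ-≤-nonNeg r {{nonNegative h}}

  monoʳ : ∀ {r p q} → 0ℚ ≤ r → p ≤ q → p * r ≤ q * r
  monoʳ {r} h = *-monoʳ-≤-nonNeg r {{nonNegative h}}

  mono* : ∀ {p q r s} → 0ℚ ≤ q → 0ℚ ≤ r → p ≤ q → r ≤ s → p * r ≤ q * s
  mono* 0≤q 0≤r p≤q r≤s = ≤-trans (monoʳ 0≤r p≤q) (monoˡ 0≤q r≤s)

  0≤* : ∀ {p q} → 0ℚ ≤ p → 0ℚ ≤ q → 0ℚ ≤ p * q
  0≤* {p} {q} hp hq = nonNegative⁻¹ (p * q) {{nonNeg*nonNeg⇒nonNeg p {{nonNegative hp}} q {{nonNegative hq}}}}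

  0≤+ : ∀ {p q} → 0ℚ ≤ p → 0ℚ ≤ q → 0ℚ ≤ p + q
  0≤+ = +-mono-≤ {0ℚ} {_} {0ℚ}

  p≤p+q : ∀ p {q} → 0ℚ ≤ q → p ≤ p + q
  p≤p+q p {q} h = subst (_≤ p + q) (+-identityʳ p) (+-monoʳ-≤ p h)

  p≤q+p : ∀ p {q} → 0ℚ ≤ q → p ≤ q + p
  p≤q+p p {q} h = subst (_≤ q + p) (+-identityˡ p) (+-monoˡ-≤ p h)

  shrink : ∀ C ε → 0ℚ ≤ C → 0ℚ < ε → ∃[ δ ] 0ℚ < δ × C * δ ≤ ε
  shrink C ε 0≤C 0<ε = δ , positive⁻¹ δ {{posδ}} , (begin
    C * δ            ≤⟨ monoʳ (<⇒≤ (positive⁻¹ δ {{posδ}})) (p≤q+p C {1ℚ} 0≤1) ⟩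
    D * (1/ D * ε)   ≡⟨ *-assoc D (1/ D) ε ⟨
    D * 1/ D * ε     ≡⟨ cong (_* ε) (*-inverseʳ D) ⟩
    1ℚ * ε           ≡⟨ *-identityˡ ε ⟩
    ε                ∎)
    where
    open ℚR
    D : ℚ
    D = 1ℚ + C
    instance
      posD : Positive D
      posD = pos+nonNeg⇒pos 1ℚ C {{nonNegative 0≤C}}
      nzD : NonZero D
      nzD = pos⇒nonZero D
      pos1/D : Positive (1/ D)
      pos1/D = 1/pos⇒pos D
    δ : ℚ
    δ = 1/ D * ε
    posδ : Positive δ
    posδ = pos*pos⇒pos (1/ D) ε {{positive 0<ε}}

  ∣-∣-≤-cong : ∀ {p q r} → p ≡ q → ∣ p ∣ ≤ r → ∣ q ∣ ≤ r
  ∣-∣-≤-cong refl h = h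

  dist-sym : ∀ p q → ∣ p - q ∣ ≡ ∣ q - p ∣
  dist-sym p q = trans (sym (∣-p∣≡∣p∣ (p - q)))
    (cong ∣_∣ (solve 2 (λ p q → :- (p :+ :- q) := q :+ :- p) refl p q))
    where open +-*-Solver

  dist-+ : ∀ a b c d → ∣ (a + b) - (c + d) ∣ ≤ ∣ a - c ∣ + ∣ b - d ∣
  dist-+ a b c d = ∣-∣-≤-cong
    (solve 4 (λ a b c d → (a :+ :- c) :+ (b :+ :- d) := (a :+ b) :+ :- (c :+ d)) refl a b c d)
    (∣p+q∣≤∣p∣+∣q∣ (a - c) (b - d))
    where open +-*-Solver

  dist-neg : ∀ a b → ∣ - a - - b ∣ ≡ ∣ a - b ∣
  dist-neg a b = trans (cong ∣_∣ (sym (neg-distrib-+ a (- b)))) (∣-p∣≡∣p∣ (a - b))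

  dist-* : ∀ a b c d → ∣ a * b - c * d ∣ ≤ ∣ a ∣ * ∣ b - d ∣ + ∣ d ∣ * ∣ a - c ∣
  dist-* a b c d = begin
    ∣ a * b - c * d ∣                        ≡⟨ cong ∣_∣ (solve 4 (λ a b c d →
      a :* b :+ :- (c :* d) := a :* (b :+ :- d) :+ d :* (a :+ :- c)) refl a b c d) ⟩
    ∣ a * (b - d) + d * (a - c) ∣            ≤⟨ ∣p+q∣≤∣p∣+∣q∣ (a * (b - d)) (d * (a - c)) ⟩
    ∣ a * (b - d) ∣ + ∣ d * (a - c) ∣        ≡⟨ cong₂ _+_ (∣p*q∣≡∣p∣*∣q∣ a (b - d)) (∣p*q∣≡∣p∣*∣q∣ d (a - c)) ⟩
    ∣ a ∣ * ∣ b - d ∣ + ∣ d ∣ * ∣ a - c ∣    ∎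
    where
    open ℚR
    open +-*-Solver

  *-close : ∀ {A B δ η ε} a b c d → 0ℚ ≤ A → 0ℚ ≤ B → ∣ a ∣ ≤ A → ∣ d ∣ ≤ B →
            ∣ b - d ∣ ≤ δ → ∣ a - c ∣ ≤ η → A * δ ≤ ½ * ε → B * η ≤ ½ * ε →
            ∣ a * b - c * d ∣ ≤ ε
  *-close {A} {B} {δ} {η} {ε} a b c d 0≤A 0≤B a≤A d≤B bd≤δ ac≤η Aδ≤ Bη≤ = begin
    ∣ a * b - c * d ∣                      ≤⟨ dist-* a b c d ⟩
    ∣ a ∣ * ∣ b - d ∣ + ∣ d ∣ * ∣ a - c ∣  ≤⟨ +-mono-≤ (mono* 0≤A (0≤∣p∣ (b - d)) a≤A bd≤δ)
                                                       (mono* 0≤B (0≤∣p∣ (a - c)) d≤B ac≤η) ⟩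
    A * δ + B * η                          ≤⟨ +-mono-≤ Aδ≤ Bη≤ ⟩
    ½ * ε + ½ * ε                          ≡⟨ halves ε ⟩
    ε                                      ∎
    where open ℚR

  ∣p∣≤∣q∣+dist : ∀ p q → ∣ p ∣ ≤ ∣ q ∣ + ∣ p - q ∣
  ∣p∣≤∣q∣+dist p q = ∣-∣-≤-cong
    (solve 2 (λ p q → q :+ (p :+ :- q) := p) refl p q) (∣p+q∣≤∣p∣+∣q∣ q (p - q))
    where open +-*-Solver

  dist≤ : ∀ {p q e} → p ≤ q + e → q ≤ p + e → ∣ p - q ∣ ≤ e
  dist≤ {p} {q} {e} h k with ∣p∣≡p∨∣p∣≡-p (p - q)
  ... | inj₁ eq = subst (_≤ e) (sym eq) (subst (p - q ≤_)
    (solve 2 (λ q e → q :+ e :+ :- q := e) refl q e) (+-monoˡ-≤ (- q) h))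
    where open +-*-Solver
  ... | inj₂ eq = subst (_≤ e) (sym eq) (subst₂ _≤_
    (solve 2 (λ p q → q :+ :- p := :- (p :+ :- q)) refl p q)
    (solve 2 (λ p e → p :+ e :+ :- p := e) refl p e) (+-monoˡ-≤ (- p) k))
    where open +-*-Solver

open ℚ-Lemmas

-- Real numbers: Cauchy sequences of rationals (with a modulus, since
-- ∃ is Σ), considered up to the equality _≈ʳ_

IsCauchy : (ℕ → ℚ) → Set
IsCauchy x = ∀ ε → 0ℚ < ε → ∃[ N ] (∀ m n → N ℕ.≤ m → N ℕ.≤ n → ∣ x m - x n ∣ ≤ ε)

record ℝ : Set where
  constructor mkℝ
  field
    seq    : ℕ → ℚ
    cauchy : IsCauchy seq
open ℝ public

infix 4 _≈ʳ_ _<ʳ_ _≤ʳ_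

_≈ʳ_ : ℝ → ℝ → Set
x ≈ʳ y = ∀ ε → 0ℚ < ε → ∃[ N ] (∀ n → N ℕ.≤ n → ∣ seq x n - seq y n ∣ ≤ ε)

_<ʳ_ : ℝ → ℝ → Set
x <ʳ y = ∃[ ε ] 0ℚ < ε × ∃[ N ] (∀ n → N ℕ.≤ n → seq x n + ε ≤ seq y n)

_≤ʳ_ : ℝ → ℝ → Set
x ≤ʳ y = ¬ (y <ʳ x)

-- The Cauchy proofs are abstract, since unfolding them is expensive and
-- only the approximating sequences matter.
abstract
  const-cauchy : ∀ q → IsCauchy (λ _ → q)
  const-cauchy q ε 0<ε = 0 , λ _ _ _ _ → subst (_≤ ε) (sym (cong ∣_∣ (+-inverseʳ q))) (<⇒≤ 0<ε)

ofℚ : ℚ → ℝ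
ofℚ q = mkℝ (λ _ → q) (const-cauchy q)

0ʳ 1ʳ : ℝ
0ʳ = ofℚ 0ℚ
1ʳ = ofℚ 1ℚ

module ℝ-Lemmas where
  ⊔ˡ : ∀ {m n k} → m ℕ.⊔ n ℕ.≤ k → m ℕ.≤ k
  ⊔ˡ {m} {n} = ℕₚ.≤-trans (ℕₚ.m≤m⊔n m n)

  ⊔ʳ : ∀ {m n k} → m ℕ.⊔ n ℕ.≤ k → n ℕ.≤ k
  ⊔ʳ {m} {n} = ℕₚ.≤-trans (ℕₚ.m≤n⊔m m n)

  eventually-bounded : ∀ x → ∃[ B ] 0ℚ ≤ B × ∃[ N ] (∀ n → N ℕ.≤ n → ∣ seq x n ∣ ≤ B)
  eventually-bounded x with cauchy x 1ℚ (positive⁻¹ 1ℚ)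
  ... | N , h = ∣ seq x N ∣ + 1ℚ , 0≤+ (0≤∣p∣ (seq x N)) 0≤1 , N ,
    λ n N≤n → ≤-trans (∣p∣≤∣q∣+dist (seq x n) (seq x N)) (+-monoʳ-≤ ∣ seq x N ∣ (h n N N≤n ℕₚ.≤-refl))

open ℝ-Lemmas

infixl 6 _+ʳ_ _-ʳ_
infixl 7 _*ʳ_
infix  8 -ʳ_

abstract
  +-cauchy : ∀ x y → IsCauchy (λ n → seq x n + seq y n)
  +-cauchy x y ε 0<ε with cauchy x (½ * ε) (0<½* 0<ε) | cauchy y (½ * ε) (0<½* 0<ε)
  ... | M , f | N , g = M ℕ.⊔ N , λ m n p q → ≤-trans (dist-+ (seq x m) (seq y m) (seq x n) (seq y n))
    (subst (_ ≤_) (halves ε) (+-mono-≤ (f m n (⊔ˡ {M} p) (⊔ˡ {M} q)) (g m n (⊔ʳ {M} p) (⊔ʳ {M} q))))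

  neg-cauchy : ∀ x → IsCauchy (λ n → - seq x n)
  neg-cauchy x ε 0<ε = proj₁ (cauchy x ε 0<ε) , λ m n p q →
    subst (_≤ ε) (sym (dist-neg (seq x m) (seq x n))) (proj₂ (cauchy x ε 0<ε) m n p q)

  *-cauchy : ∀ x y → IsCauchy (λ n → seq x n * seq y n)
  *-cauchy x y ε 0<ε =
    let A , 0≤A , K , a = eventually-bounded x
        B , 0≤B , L , b = eventually-bounded y
        δ , 0<δ , Aδ≤ = shrink A (½ * ε) 0≤A (0<½* 0<ε)
        η , 0<η , Bη≤ = shrink B (½ * ε) 0≤B (0<½* 0<ε)
        M , f = cauchy y δ 0<δ
        N , g = cauchy x η 0<η
    in (K ℕ.⊔ L) ℕ.⊔ (M ℕ.⊔ N) , λ m n p q →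
    *-close (seq x m) (seq y m) (seq x n) (seq y n) 0≤A 0≤B
      (a m (⊔ˡ {K} {L} (⊔ˡ {K ℕ.⊔ L} {M ℕ.⊔ N} p)))
      (b n (⊔ʳ {K} {L} (⊔ˡ {K ℕ.⊔ L} {M ℕ.⊔ N} q)))
      (f m n (⊔ˡ {M} {N} (⊔ʳ {K ℕ.⊔ L} {M ℕ.⊔ N} p)) (⊔ˡ {M} {N} (⊔ʳ {K ℕ.⊔ L} {M ℕ.⊔ N} q)))
      (g m n (⊔ʳ {M} {N} (⊔ʳ {K ℕ.⊔ L} {M ℕ.⊔ N} p)) (⊔ʳ {M} {N} (⊔ʳ {K ℕ.⊔ L} {M ℕ.⊔ N} q)))
      Aδ≤ Bη≤

_+ʳ_ : ℝ → ℝ → ℝ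
x +ʳ y = mkℝ (λ n → seq x n + seq y n) (+-cauchy x y)

-ʳ_ : ℝ → ℝ
-ʳ x = mkℝ (λ n → - seq x n) (neg-cauchy x)

_-ʳ_ : ℝ → ℝ → ℝ
x -ʳ y = x +ʳ (-ʳ y)

_*ʳ_ : ℝ → ℝ → ℝ
x *ʳ y = mkℝ (λ n → seq x n * seq y n) (*-cauchy x y)

-- Reciprocals of rationals, with the junk value 0 at 0: a positive real
-- may have finitely many vanishing approximants.
recipℚ : ℚ → ℚ
recipℚ q with q ≟ 0ℚ
... | yes _  = 0ℚ
... | no q≢0 = (1/ q) {{≢-nonZero q≢0}}

module recip-Lemmas where
  *-recipℚ : ∀ {q} → 0ℚ < q → q * recipℚ q ≡ 1ℚ
  *-recipℚ {q} 0<q with q ≟ 0ℚ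
  ... | yes q≡0 = ⊥-elim (<⇒≢ 0<q (sym q≡0))
  ... | no q≢0  = *-inverseʳ q {{≢-nonZero q≢0}}

  0≤recipℚ : ∀ {q} → 0ℚ < q → 0ℚ ≤ recipℚ q
  0≤recipℚ {q} 0<q with q ≟ 0ℚ
  ... | yes _  = ≤-refl
  ... | no q≢0 = <⇒≤ (positive⁻¹ _ {{1/pos⇒pos q {{positive 0<q}}}})

  recipℚ-antimono : ∀ {p q} → 0ℚ < p → p ≤ q → recipℚ q ≤ recipℚ p
  recipℚ-antimono {p} {q} 0<p p≤q = begin
    recipℚ q                    ≡⟨ *-identityˡ (recipℚ q) ⟨
    1ℚ * recipℚ q               ≡⟨ cong (_* recipℚ q) (*-recipℚ 0<p) ⟨
    p * recipℚ p * recipℚ q     ≤⟨ monoʳ (0≤recipℚ 0<q) (monoʳ (0≤recipℚ 0<p) p≤q) ⟩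
    q * recipℚ p * recipℚ q     ≡⟨ solve 3 (λ q a b → q :* a :* b := a :* (q :* b)) refl q (recipℚ p) (recipℚ q) ⟩
    recipℚ p * (q * recipℚ q)   ≡⟨ cong (recipℚ p *_) (*-recipℚ 0<q) ⟩
    recipℚ p * 1ℚ               ≡⟨ *-identityʳ (recipℚ p) ⟩
    recipℚ p                    ∎
    where
    open ℚR
    open +-*-Solver
    0<q : 0ℚ < q
    0<q = <-≤-trans 0<p p≤q

  dist-recipℚ : ∀ {e p q} → 0ℚ < e → e ≤ p → e ≤ q →
                ∣ recipℚ p - recipℚ q ∣ ≤ recipℚ e * recipℚ e * ∣ p - q ∣
  dist-recipℚ {e} {p} {q} 0<e e≤p e≤q = begin
    ∣ a - b ∣                       ≡⟨ cong ∣_∣ (cong₂ _-_ (sym (*-identityʳ a)) (sym (*-identityʳ b))) ⟩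
    ∣ a * 1ℚ - b * 1ℚ ∣             ≡⟨ cong ∣_∣ (cong₂ (λ s t → a * s - b * t) (sym (*-recipℚ 0<q)) (sym (*-recipℚ 0<p))) ⟩
    ∣ a * (q * b) - b * (p * a) ∣   ≡⟨ cong ∣_∣ (solve 4 (λ a b p q →
      a :* (q :* b) :+ :- (b :* (p :* a)) := (a :* b) :* (q :+ :- p)) refl a b p q) ⟩
    ∣ a * b * (q - p) ∣             ≡⟨ ∣p*q∣≡∣p∣*∣q∣ (a * b) (q - p) ⟩
    ∣ a * b ∣ * ∣ q - p ∣           ≡⟨ cong₂ _*_ (0≤p⇒∣p∣≡p (0≤* 0≤a 0≤b)) (dist-sym q p) ⟩
    a * b * ∣ p - q ∣               ≤⟨ monoʳ (0≤∣p∣ (p - q)) (mono* (0≤recipℚ 0<e) 0≤b (recipℚ-antimono 0<e e≤p) (recipℚ-antimono 0<e e≤q)) ⟩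
    recipℚ e * recipℚ e * ∣ p - q ∣ ∎
    where
    open ℚR
    open +-*-Solver
    a b : ℚ
    a = recipℚ p
    b = recipℚ q
    0<p : 0ℚ < p
    0<p = <-≤-trans 0<e e≤p
    0<q : 0ℚ < q
    0<q = <-≤-trans 0<e e≤q
    0≤a : 0ℚ ≤ a
    0≤a = 0≤recipℚ 0<p
    0≤b : 0ℚ ≤ b
    0≤b = 0≤recipℚ 0<q

open recip-Lemmas

abstract
  recip-cauchy : ∀ x → 0ʳ <ʳ x → IsCauchy (λ n → recipℚ (seq x n))
  recip-cauchy x (e , 0<e , K , e≤) = proof
    where
    e≤x : ∀ n → K ℕ.≤ n → e ≤ seq x n
    e≤x n K≤n = subst (_≤ seq x n) (+-identityˡ e) (e≤ n K≤n)
    0≤C : 0ℚ ≤ recipℚ e * recipℚ e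
    0≤C = 0≤* (0≤recipℚ 0<e) (0≤recipℚ 0<e)
    proof : IsCauchy (λ n → recipℚ (seq x n))
    proof ε 0<ε =
      let δ , 0<δ , Cδ≤ε = shrink (recipℚ e * recipℚ e) ε 0≤C 0<ε
          N , f = cauchy x δ 0<δ
      in K ℕ.⊔ N , λ m n p q → ≤-trans
        (dist-recipℚ 0<e (e≤x m (⊔ˡ {K} p)) (e≤x n (⊔ˡ {K} q)))
        (≤-trans (monoˡ 0≤C (f m n (⊔ʳ {K} p) (⊔ʳ {K} q))) Cδ≤ε)

recipʳ : (x : ℝ) → 0ʳ <ʳ x → ℝ
recipʳ x 0<x = mkℝ (λ n → recipℚ (seq x n)) (recip-cauchy x 0<x)

-- ⌊√n⌋
isqrt : ℕ → ℕ
isqrt zero = 0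
isqrt (suc n) with suc (isqrt n) ℕ.* suc (isqrt n) ℕₚ.≤? suc n
... | yes _ = suc (isqrt n)
... | no  _ = isqrt n

module √5-bounds where
  isqrt-lower : ∀ n → isqrt n ℕ.* isqrt n ℕ.≤ n
  isqrt-lower zero = ℕ.z≤n
  isqrt-lower (suc n) with suc (isqrt n) ℕ.* suc (isqrt n) ℕₚ.≤? suc n
  ... | yes h = h
  ... | no  _ = ℕₚ.m≤n⇒m≤1+n (isqrt-lower n)

  isqrt-upper : ∀ n → n ℕ.< suc (isqrt n) ℕ.* suc (isqrt n)
  isqrt-upper zero = ℕ.s≤s ℕ.z≤n
  isqrt-upper (suc n) with suc (isqrt n) ℕ.* suc (isqrt n) ℕₚ.≤? suc n
  ... | yes _ = ℕₚ.≤-<-trans (isqrt-upper n)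
    (ℕₚ.*-mono-< (ℕₚ.n<1+n (suc (isqrt n))) (ℕₚ.n<1+n (suc (isqrt n))))
  ... | no  h = ℕₚ.≰⇒> h

  ℕ-sq-cancel : ∀ {m n} → m ℕ.* m ℕ.< n ℕ.* n → m ℕ.< n
  ℕ-sq-cancel {m} {n} h = ℕₚ.≰⇒> λ n≤m → ℕₚ.<⇒≱ h (ℕₚ.*-mono-≤ n≤m n≤m)

  √5-num : ℕ → ℕ
  √5-num n = isqrt (5 ℕ.* (suc n ℕ.* suc n))

  √5-cross : ∀ m n → √5-num m ℕ.* suc n ℕ.≤ suc (√5-num n) ℕ.* suc m
  √5-cross m n = ℕₚ.<⇒≤ (ℕ-sq-cancel (begin-strict
    (a ℕ.* t) ℕ.* (a ℕ.* t)            ≡⟨ swap a t ⟩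
    (a ℕ.* a) ℕ.* (t ℕ.* t)            ≤⟨ ℕₚ.*-monoˡ-≤ (t ℕ.* t) (isqrt-lower (5 ℕ.* (s ℕ.* s))) ⟩
    5 ℕ.* (s ℕ.* s) ℕ.* (t ℕ.* t)      ≡⟨ swap5 s t ⟩
    5 ℕ.* (t ℕ.* t) ℕ.* (s ℕ.* s)      <⟨ ℕₚ.*-monoˡ-< (s ℕ.* s) (isqrt-upper (5 ℕ.* (t ℕ.* t))) ⟩
    (suc b ℕ.* suc b) ℕ.* (s ℕ.* s)    ≡⟨ swap (suc b) s ⟨
    (suc b ℕ.* s) ℕ.* (suc b ℕ.* s)    ∎))
    where
    open ℕₚ.≤-Reasoning
    a b s t : ℕ
    a = √5-num m
    b = √5-num n
    s = suc m
    t = suc n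
    open ℕSolver.+-*-Solver
    swap : ∀ a t → (a ℕ.* t) ℕ.* (a ℕ.* t) ≡ (a ℕ.* a) ℕ.* (t ℕ.* t)
    swap = solve 2 (λ a t → (a :* t) :* (a :* t) := (a :* a) :* (t :* t)) refl
    swap5 : ∀ s t → 5 ℕ.* (s ℕ.* s) ℕ.* (t ℕ.* t) ≡ 5 ℕ.* (t ℕ.* t) ℕ.* (s ℕ.* s)
    swap5 = solve 2 (λ s t → con 5 :* (s :* s) :* (t :* t) := con 5 :* (t :* t) :* (s :* s)) refl

open √5-bounds

-- ⌊(n+1)√5⌋ / (n+1)
√5-seq : ℕ → ℚ
√5-seq n = fromℕ (isqrt (5 ℕ.* (suc n ℕ.* suc n))) ÷ fromℕ (suc n)

module √5-Lemmas where
  0≤1/suc : ∀ n → 0ℚ ≤ 1/ fromℕ (suc n)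
  0≤1/suc n = nonNegative⁻¹ (1/ fromℕ (suc n))

  ÷-cross : ∀ a b m n → a ℕ.* suc n ℕ.≤ b ℕ.* suc m → fromℕ a ÷ fromℕ (suc m) ≤ fromℕ b ÷ fromℕ (suc n)
  ÷-cross a b m n h = begin
    A * u               ≡⟨ *-identityʳ (A * u) ⟨
    A * u * 1ℚ          ≡⟨ cong (A * u *_) (*-inverseʳ (fromℕ (suc n))) ⟨
    A * u * (T * v)     ≡⟨ solve 4 (λ A u T v → A :* u :* (T :* v) := A :* T :* (u :* v)) refl A u T v ⟩
    A * T * (u * v)     ≤⟨ monoʳ (0≤* (0≤1/suc m) (0≤1/suc n)) (subst₂ _≤_ (fromℕ-* a (suc n)) (fromℕ-* b (suc m)) (fromℕ-mono h)) ⟩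
    B * S * (u * v)     ≡⟨ solve 4 (λ B S u v → B :* S :* (u :* v) := B :* v :* (S :* u)) refl B S u v ⟩
    B * v * (S * u)     ≡⟨ cong (B * v *_) (*-inverseʳ (fromℕ (suc m))) ⟩
    B * v * 1ℚ          ≡⟨ *-identityʳ (B * v) ⟩
    B * v               ∎
    where
    open ℚR
    open +-*-Solver
    A B S T u v : ℚ
    A = fromℕ a
    B = fromℕ b
    S = fromℕ (suc m)
    T = fromℕ (suc n)
    u = 1/ S
    v = 1/ T

  √5-close : ∀ m n → √5-seq m ≤ √5-seq n + 1/ fromℕ (suc n)
  √5-close m n = begin
    √5-seq m                              ≤⟨ ÷-cross (√5-num m) (suc (√5-num n)) m n (√5-cross m n) ⟩
    fromℕ (1 ℕ.+ √5-num n) ÷ T            ≡⟨ cong (_* 1/ T) (fromℕ-+ 1 (√5-num n)) ⟩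
    (1ℚ + fromℕ (√5-num n)) * 1/ T        ≡⟨ *-distribʳ-+ (1/ T) 1ℚ (fromℕ (√5-num n)) ⟩
    1ℚ * 1/ T + √5-seq n                  ≡⟨ cong (_+ √5-seq n) (*-identityˡ (1/ T)) ⟩
    1/ T + √5-seq n                       ≡⟨ +-comm (1/ T) (√5-seq n) ⟩
    √5-seq n + 1/ T                       ∎
    where
    open ℚR
    T : ℚ
    T = fromℕ (suc n)

  1/suc-antimono : ∀ {m n} → m ℕ.≤ n → 1/ fromℕ (suc n) ≤ 1/ fromℕ (suc m)
  1/suc-antimono {m} {n} h = subst₂ _≤_ (*-identityˡ (1/ fromℕ (suc n))) (*-identityˡ (1/ fromℕ (suc m)))
    (÷-cross 1 1 n m (ℕₚ.*-monoʳ-≤ 1 (ℕ.s≤s h)))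

  1/suc-small : ∀ ε → 0ℚ < ε → ∃[ N ] (∀ n → N ℕ.≤ n → 1/ fromℕ (suc n) ≤ ε)
  1/suc-small ε 0<ε with archimedean (recipℚ ε)
  ... | N , h = N , λ n N≤n → begin
    1/ S n                      ≡⟨ *-identityʳ (1/ S n) ⟨
    1/ S n * 1ℚ                 ≡⟨ cong (1/ S n *_) (*-recipℚ 0<ε) ⟨
    1/ S n * (ε * recipℚ ε)     ≤⟨ monoˡ (0≤1/suc n) (monoˡ (<⇒≤ 0<ε) (≤-trans h (fromℕ-mono (ℕₚ.m≤n⇒m≤1+n N≤n)))) ⟩
    1/ S n * (ε * S n)          ≡⟨ solve 3 (λ u e s → u :* (e :* s) := e :* (s :* u)) refl (1/ S n) ε (S n) ⟩
    ε * (S n * 1/ S n)          ≡⟨ cong (ε *_) (*-inverseʳ (S n)) ⟩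
    ε * 1ℚ                      ≡⟨ *-identityʳ ε ⟩
    ε                           ∎
    where
    open ℚR
    open +-*-Solver
    S : ℕ → ℚ
    S n = fromℕ (suc n)

open √5-Lemmas

abstract
  √5-cauchy : IsCauchy √5-seq
  √5-cauchy ε 0<ε = let N , h = 1/suc-small ε 0<ε in N , λ m n p q → dist≤
    (≤-trans (√5-close m n) (+-monoʳ-≤ (√5-seq n) (h n q)))
    (≤-trans (√5-close n m) (+-monoʳ-≤ (√5-seq m) (h m p)))

√5 : ℝ
√5 = mkℝ √5-seq √5-cauchy

module √5-Properties where
  1≤√5 : ∀ n → 1ℚ ≤ √5-seq n
  1≤√5 n = ÷-cross 1 (√5-num n) 0 n (subst₂ ℕ._≤_ (sym (ℕₚ.*-identityˡ (suc n))) (sym (ℕₚ.*-identityʳ (√5-num n)))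
    (ℕₚ.≤-pred (ℕ-sq-cancel {suc n} {suc (√5-num n)} (ℕₚ.≤-<-trans
      (ℕₚ.m≤n*m (suc n ℕ.* suc n) 5) (isqrt-upper (5 ℕ.* (suc n ℕ.* suc n)))))))

  0≤√5 : ∀ n → 0ℚ ≤ √5-seq n
  0≤√5 n = ≤-trans 0≤1 (1≤√5 n)

  √5≤3 : ∀ n → √5-seq n ≤ fromℕ 3
  √5≤3 n = √5-close n 0

  module Square (n : ℕ) where
    t : ℕ
    t = suc n

    T u x : ℚ
    T = fromℕ t
    u = 1/ T
    x = √5-seq n

    5t²u² : fromℕ (5 ℕ.* (t ℕ.* t)) * (u * u) ≡ fromℕ 5
    5t²u² = begin-equality
      fromℕ (5 ℕ.* (t ℕ.* t)) * (u * u)   ≡⟨ cong (_* (u * u)) (trans (fromℕ-* 5 (t ℕ.* t)) (cong (fromℕ 5 *_) (fromℕ-* t t))) ⟩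
      fromℕ 5 * (T * T) * (u * u)         ≡⟨ solve 3 (λ f T u → f :* (T :* T) :* (u :* u) := f :* ((T :* u) :* (T :* u))) refl (fromℕ 5) T u ⟩
      fromℕ 5 * ((T * u) * (T * u))       ≡⟨ cong (λ r → fromℕ 5 * (r * r)) (*-inverseʳ T) ⟩
      fromℕ 5 * (1ℚ * 1ℚ)                 ≡⟨⟩
      fromℕ 5                             ∎
      where
      open ℚR
      open +-*-Solver

    square : ∀ a → (fromℕ a * u) * (fromℕ a * u) ≡ fromℕ (a ℕ.* a) * (u * u)
    square a = trans (solve 2 (λ A u → (A :* u) :* (A :* u) := (A :* A) :* (u :* u)) refl (fromℕ a) u)
      (cong (_* (u * u)) (sym (fromℕ-* a a)))
      where open +-*-Solver

    0≤u² : 0ℚ ≤ u * u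
    0≤u² = 0≤* (0≤1/suc n) (0≤1/suc n)

    √5²-upper : x * x ≤ fromℕ 5
    √5²-upper = begin
      x * x                                          ≡⟨ square (√5-num n) ⟩
      fromℕ (√5-num n ℕ.* √5-num n) * (u * u)        ≤⟨ monoʳ 0≤u² (fromℕ-mono (isqrt-lower (5 ℕ.* (t ℕ.* t)))) ⟩
      fromℕ (5 ℕ.* (t ℕ.* t)) * (u * u)              ≡⟨ 5t²u² ⟩
      fromℕ 5                                        ∎
      where open ℚR

    √5²-lower : fromℕ 5 ≤ x * x + fromℕ 7 * u
    √5²-lower = begin
      fromℕ 5                                                  ≡⟨ 5t²u² ⟨
      fromℕ (5 ℕ.* (t ℕ.* t)) * (u * u)                        ≤⟨ monoʳ 0≤u² (fromℕ-mono (ℕₚ.<⇒≤ (isqrt-upper (5 ℕ.* (t ℕ.* t))))) ⟩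
      fromℕ (suc (√5-num n) ℕ.* suc (√5-num n)) * (u * u)      ≡⟨ square (suc (√5-num n)) ⟨
      (fromℕ (suc (√5-num n)) * u) * (fromℕ (suc (√5-num n)) * u)
        ≡⟨ cong (λ r → (r * u) * (r * u)) (fromℕ-+ 1 (√5-num n)) ⟩
      ((1ℚ + fromℕ (√5-num n)) * u) * ((1ℚ + fromℕ (√5-num n)) * u)
        ≡⟨ solve 2 (λ A u → ((con 1ℚ :+ A) :* u) :* ((con 1ℚ :+ A) :* u)
             := (A :* u) :* (A :* u) :+ (A :* u :+ A :* u :+ u) :* u) refl (fromℕ (√5-num n)) u ⟩
      x * x + (x + x + u) * u
        ≤⟨ +-monoʳ-≤ (x * x) (monoʳ (0≤1/suc n) (+-mono-≤ (+-mono-≤ (√5≤3 n) (√5≤3 n)) (1/suc-antimono {0} {n} ℕ.z≤n))) ⟩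
      x * x + fromℕ 7 * u                                      ∎
      where
      open ℚR
      open +-*-Solver

  √5*√5≈5 : √5 *ʳ √5 ≈ʳ ofℚ (fromℕ 5)
  √5*√5≈5 ε 0<ε =
    let δ , 0<δ , 7δ≤ε = shrink (fromℕ 7) ε (0≤fromℕ 7) 0<ε
        N , h = 1/suc-small δ 0<δ
    in N , λ n p → dist≤
      (≤-trans (Square.√5²-upper n) (p≤p+q (fromℕ 5) (<⇒≤ 0<ε)))
      (≤-trans (Square.√5²-lower n) (+-monoʳ-≤ (√5-seq n * √5-seq n) (≤-trans (monoˡ (0≤fromℕ 7) (h n p)) 7δ≤ε)))

open √5-Properties

record ℂ : Set where
  constructor _+i_
  field
    re : ℝ
    im : ℝ
open ℂ public

infix 4 _≈_ _#0
infixl 6 _+ᶜ_ _-ᶜ_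
infixl 7 _*ᶜ_ _/ᶜ_[_]
infix  8 -ᶜ_

_≈_ : ℂ → ℂ → Set
z ≈ w = (re z ≈ʳ re w) × (im z ≈ʳ im w)

ofℝ : ℝ → ℂ
ofℝ x = x +i 0ʳ

0ᶜ 1ᶜ 2ᶜ 𝕚 : ℂ
0ᶜ = ofℝ 0ʳ
1ᶜ = ofℝ 1ʳ
2ᶜ = ofℝ (ofℚ (fromℕ 2))
𝕚  = 0ʳ +i 1ʳ

_+ᶜ_ : ℂ → ℂ → ℂ
z +ᶜ w = (re z +ʳ re w) +i (im z +ʳ im w)

-ᶜ_ : ℂ → ℂ
-ᶜ z = (-ʳ re z) +i (-ʳ im z)

_-ᶜ_ : ℂ → ℂ → ℂ
z -ᶜ w = z +ᶜ (-ᶜ w)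

_*ᶜ_ : ℂ → ℂ → ℂ
z *ᶜ w = (re z *ʳ re w -ʳ im z *ʳ im w) +i (re z *ʳ im w +ʳ im z *ʳ re w)

∣_∣² : ℂ → ℝ
∣ z ∣² = re z *ʳ re z +ʳ im z *ʳ im z

-- apartness from zero, the constructive form of z ≠ 0
_#0 : ℂ → Set
z #0 = 0ʳ <ʳ ∣ z ∣²

_/ᶜ_[_] : ℂ → (w : ℂ) → w #0 → ℂ
z /ᶜ w [ w#0 ] = z *ᶜ ((re w *ʳ recipʳ ∣ w ∣² w#0) +i (-ʳ im w *ʳ recipʳ ∣ w ∣² w#0))

invFactorial : ℕ → ℚ
invFactorial zero    = 1ℚ
invFactorial (suc k) = invFactorial k * 1/ fromℕ (suc k)

record ℚ[i] : Set where
  constructor _⊹_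
  field
    reℚ : ℚ
    imℚ : ℚ
open ℚ[i] public

infix  5 _⊹_
infixl 6 _⊕_ _⊖_
infixl 7 _⊗_

_⊕_ _⊖_ _⊗_ : ℚ[i] → ℚ[i] → ℚ[i]
(a ⊹ b) ⊕ (c ⊹ d) = (a + c) ⊹ (b + d)
(a ⊹ b) ⊖ (c ⊹ d) = (a - c) ⊹ (b - d)
(a ⊹ b) ⊗ (c ⊹ d) = (a * c - b * d) ⊹ (a * d + b * c)

pow : ℚ[i] → ℕ → ℚ[i]
pow z zero    = 1ℚ ⊹ 0ℚ
pow z (suc k) = z ⊗ pow z k

-- Σ_{k<n} zᵏ / k!
expℚ : ℕ → ℚ[i] → ℚ[i]
expℚ zero    z = 0ℚ ⊹ 0ℚ
expℚ (suc n) z = expℚ n z ⊕ ((invFactorial n ⊹ 0ℚ) ⊗ pow z n)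

‖_‖ : ℚ[i] → ℚ
‖ z ‖ = ∣ reℚ z ∣ + ∣ imℚ z ∣

approx : ℂ → ℕ → ℚ[i]
approx z n = seq (re z) n ⊹ seq (im z) n

module exp-Lemmas where
  0≤‖‖ : ∀ z → 0ℚ ≤ ‖ z ‖
  0≤‖‖ z = 0≤+ (0≤∣p∣ (reℚ z)) (0≤∣p∣ (imℚ z))

  ∣re∣≤ : ∀ z → ∣ reℚ z ∣ ≤ ‖ z ‖
  ∣re∣≤ z = p≤p+q ∣ reℚ z ∣ (0≤∣p∣ (imℚ z))

  ∣im∣≤ : ∀ z → ∣ imℚ z ∣ ≤ ‖ z ‖
  ∣im∣≤ z = p≤q+p ∣ imℚ z ∣ (0≤∣p∣ (reℚ z))

  ‖⊕‖ : ∀ z w → ‖ z ⊕ w ‖ ≤ ‖ z ‖ + ‖ w ‖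
  ‖⊕‖ (a ⊹ b) (c ⊹ d) = begin
    ∣ a + c ∣ + ∣ b + d ∣                  ≤⟨ +-mono-≤ (∣p+q∣≤∣p∣+∣q∣ a c) (∣p+q∣≤∣p∣+∣q∣ b d) ⟩
    (∣ a ∣ + ∣ c ∣) + (∣ b ∣ + ∣ d ∣)      ≡⟨ solve 4 (λ a b c d → (a :+ c) :+ (b :+ d) := (a :+ b) :+ (c :+ d)) refl (∣ a ∣) (∣ b ∣) (∣ c ∣) (∣ d ∣) ⟩
    (∣ a ∣ + ∣ b ∣) + (∣ c ∣ + ∣ d ∣)      ∎
    where
    open ℚR
    open +-*-Solver

  ‖⊗‖ : ∀ z w → ‖ z ⊗ w ‖ ≤ ‖ z ‖ * ‖ w ‖
  ‖⊗‖ (a ⊹ b) (c ⊹ d) = begin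
    ∣ a * c - b * d ∣ + ∣ a * d + b * c ∣
      ≤⟨ +-mono-≤ (∣p-q∣≤∣p∣+∣q∣ (a * c) (b * d)) (∣p+q∣≤∣p∣+∣q∣ (a * d) (b * c)) ⟩
    (∣ a * c ∣ + ∣ b * d ∣) + (∣ a * d ∣ + ∣ b * c ∣)
      ≡⟨ cong₂ _+_ (cong₂ _+_ (∣p*q∣≡∣p∣*∣q∣ a c) (∣p*q∣≡∣p∣*∣q∣ b d)) (cong₂ _+_ (∣p*q∣≡∣p∣*∣q∣ a d) (∣p*q∣≡∣p∣*∣q∣ b c)) ⟩
    (∣ a ∣ * ∣ c ∣ + ∣ b ∣ * ∣ d ∣) + (∣ a ∣ * ∣ d ∣ + ∣ b ∣ * ∣ c ∣)
      ≡⟨ solve 4 (λ a b c d → (a :* c :+ b :* d) :+ (a :* d :+ b :* c) := (a :+ b) :* (c :+ d)) refl (∣ a ∣) (∣ b ∣) (∣ c ∣) (∣ d ∣) ⟩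
    (∣ a ∣ + ∣ b ∣) * (∣ c ∣ + ∣ d ∣) ∎
    where
    open ℚR
    open +-*-Solver

  ‖⊖‖-self : ∀ z → ‖ z ⊖ z ‖ ≡ 0ℚ
  ‖⊖‖-self (a ⊹ b) = cong₂ (λ (s t : ℚ) → ∣ s ∣ + ∣ t ∣) {a - a} {0ℚ} {b - b} {0ℚ} (+-inverseʳ a) (+-inverseʳ b)

  ‖⊖‖-sym : ∀ z w → ‖ z ⊖ w ‖ ≡ ‖ w ⊖ z ‖
  ‖⊖‖-sym (a ⊹ b) (c ⊹ d) = cong₂ _+_ (dist-sym a c) (dist-sym b d)

  ‖⊖‖-triangle : ∀ z v w → ‖ z ⊖ w ‖ ≤ ‖ z ⊖ v ‖ + ‖ v ⊖ w ‖
  ‖⊖‖-triangle z@(a ⊹ b) v@(c ⊹ d) w@(e ⊹ f) = subst (λ t → ‖ t ‖ ≤ ‖ z ⊖ v ‖ + ‖ v ⊖ w ‖)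
    (cong₂ _⊹_ (lemma a c e) (lemma b d f)) (‖⊕‖ (z ⊖ v) (v ⊖ w))
    where
    open +-*-Solver
    lemma : ∀ p q r → (p - q) + (q - r) ≡ p - r
    lemma = solve 3 (λ p q r → (p :+ :- q) :+ (q :+ :- r) := p :+ :- r) refl

  ⊖-⊕ : ∀ z w u v → (z ⊕ w) ⊖ (u ⊕ v) ≡ (z ⊖ u) ⊕ (w ⊖ v)
  ⊖-⊕ (a ⊹ b) (c ⊹ d) (e ⊹ f) (g ⊹ h) = cong₂ _⊹_ (lemma a c e g) (lemma b d f h)
    where
    open +-*-Solver
    lemma : ∀ p q r s → (p + q) - (r + s) ≡ (p - r) + (q - s)
    lemma = solve 4 (λ p q r s → (p :+ q) :+ :- (r :+ s) := (p :+ :- r) :+ (q :+ :- s)) refl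

  ⊕-⊖ : ∀ z w u → (z ⊕ w) ⊖ u ≡ (z ⊖ u) ⊕ w
  ⊕-⊖ (a ⊹ b) (c ⊹ d) (e ⊹ f) = cong₂ _⊹_ (lemma a c e) (lemma b d f)
    where
    open +-*-Solver
    lemma : ∀ p q r → (p + q) - r ≡ (p - r) + q
    lemma = solve 3 (λ p q r → (p :+ q) :+ :- r := (p :+ :- r) :+ q) refl

  ⊗-⊖ : ∀ z w u v → (z ⊗ w) ⊖ (u ⊗ v) ≡ (z ⊗ (w ⊖ v)) ⊕ ((z ⊖ u) ⊗ v)
  ⊗-⊖ (a ⊹ b) (c ⊹ d) (e ⊹ f) (g ⊹ h) = cong₂ _⊹_
    (solve 8 (λ a b c d e f g h → (a :* c :+ :- (b :* d)) :+ :- (e :* g :+ :- (f :* h)) :=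
      (a :* (c :+ :- g) :+ :- (b :* (d :+ :- h))) :+ ((a :+ :- e) :* g :+ :- ((b :+ :- f) :* h)))
      refl a b c d e f g h)
    (solve 8 (λ a b c d e f g h → (a :* d :+ b :* c) :+ :- (e :* h :+ f :* g) :=
      (a :* (d :+ :- h) :+ b :* (c :+ :- g)) :+ ((a :+ :- e) :* h :+ (b :+ :- f) :* g))
      refl a b c d e f g h)
    where open +-*-Solver

  ⊗-distrib-⊖ : ∀ z w v → (z ⊗ w) ⊖ (z ⊗ v) ≡ z ⊗ (w ⊖ v)
  ⊗-distrib-⊖ (a ⊹ b) (c ⊹ d) (g ⊹ h) = cong₂ _⊹_
    (solve 6 (λ a b c d g h → (a :* c :+ :- (b :* d)) :+ :- (a :* g :+ :- (b :* h)) :=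
      a :* (c :+ :- g) :+ :- (b :* (d :+ :- h))) refl a b c d g h)
    (solve 6 (λ a b c d g h → (a :* d :+ b :* c) :+ :- (a :* h :+ b :* g) :=
      a :* (d :+ :- h) :+ b :* (c :+ :- g)) refl a b c d g h)
    where open +-*-Solver

  0≤invFactorial : ∀ k → 0ℚ ≤ invFactorial k
  0≤invFactorial zero    = 0≤1
  0≤invFactorial (suc k) = 0≤* (0≤invFactorial k) (0≤1/suc k)

  ‖invFactorial‖ : ∀ k → ‖ invFactorial k ⊹ 0ℚ ‖ ≡ invFactorial k
  ‖invFactorial‖ k = trans (+-identityʳ ∣ invFactorial k ∣) (0≤p⇒∣p∣≡p (0≤invFactorial k))

  -- the majorant Σ Bᵏ/k! with B a natural number
  module Majorant (β : ℕ) where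
    B : ℚ
    B = fromℕ β

    0≤B : 0ℚ ≤ B
    0≤B = 0≤fromℕ β

    powB : ℕ → ℚ
    powB zero    = 1ℚ
    powB (suc k) = B * powB k

    0≤powB : ∀ k → 0ℚ ≤ powB k
    0≤powB zero    = 0≤1
    0≤powB (suc k) = 0≤* 0≤B (0≤powB k)

    b : ℕ → ℚ
    b k = invFactorial k * powB k

    0≤b : ∀ k → 0ℚ ≤ b k
    0≤b k = 0≤* (0≤invFactorial k) (0≤powB k)

    s : ℕ → ℚ
    s zero    = 0ℚ
    s (suc n) = s n + b n

    b-suc : ∀ k → b (suc k) ≡ b k * (B * 1/ fromℕ (suc k))
    b-suc k = solve 4 (λ f u B p → f :* u :* (B :* p) := f :* p :* (B :* u)) refl
      (invFactorial k) (1/ fromℕ (suc k)) B (powB k)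
      where open +-*-Solver

    K : ℕ
    K = β ℕ.* 2

    b-half : ∀ k → K ℕ.≤ k → b (suc k) ≤ b k * ½
    b-half k K≤k = subst (_≤ b k * ½) (sym (b-suc k)) (monoˡ (0≤b k)
      (÷-cross β 1 k 1 (ℕₚ.≤-trans K≤k (ℕₚ.≤-trans (ℕₚ.n≤1+n k) (ℕₚ.≤-reflexive (sym (ℕₚ.*-identityˡ (suc k))))))))

    ½-double : ∀ p → p * ½ + p * ½ ≡ p
    ½-double p = trans (sym (*-distribˡ-+ p ½ ½)) (*-identityʳ p)

    b-decr : ∀ k → K ℕ.≤ k → b (suc k) ≤ b k
    b-decr k K≤k = ≤-trans (b-half k K≤k)
      (subst (b k * ½ ≤_) (½-double (b k)) (p≤p+q (b k * ½) (0≤* (0≤b k) (nonNegative⁻¹ ½))))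

    antitone : (f : ℕ → ℚ) → (∀ k → K ℕ.≤ k → f (suc k) ≤ f k) → ∀ {m n} → K ℕ.≤ m → m ℕ.≤′ n → f n ≤ f m
    antitone f step K≤m (ℕ.≤′-reflexive refl) = ≤-refl
    antitone f step K≤m (ℕ.≤′-step m≤n) = ≤-trans (step _ (ℕₚ.≤-trans K≤m (ℕₚ.≤′⇒≤ m≤n))) (antitone f step K≤m m≤n)

    s-mono : ∀ {m n} → m ℕ.≤′ n → s m ≤ s n
    s-mono (ℕ.≤′-reflexive refl) = ≤-refl
    s-mono (ℕ.≤′-step {n} m≤n) = ≤-trans (s-mono m≤n) (p≤p+q (s n) (0≤b n))

    v : ℕ → ℚ
    v n = s n + (b n + b n)

    s≤v : ∀ n → s n ≤ v n
    s≤v n = p≤p+q (s n) (0≤+ (0≤b n) (0≤b n))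

    v-decr : ∀ k → K ℕ.≤ k → v (suc k) ≤ v k
    v-decr k K≤k = begin
      s k + b k + (b (suc k) + b (suc k))   ≤⟨ +-monoʳ-≤ (s k + b k) (+-mono-≤ (b-half k K≤k) (b-half k K≤k)) ⟩
      s k + b k + (b k * ½ + b k * ½)       ≡⟨ cong (λ t → s k + b k + t) (½-double (b k)) ⟩
      s k + b k + b k                       ≡⟨ +-assoc (s k) (b k) (b k) ⟩
      s k + (b k + b k)                     ∎
      where open ℚR

    S : ℚ
    S = v K

    0≤S : 0ℚ ≤ S
    0≤S = ≤-trans (s-mono {0} {K} (ℕₚ.≤⇒≤′ ℕ.z≤n)) (s≤v K)

    s-bounded : ∀ n → s n ≤ S
    s-bounded n with ℕₚ.≤-total n K
    ... | inj₁ n≤K = ≤-trans (s-mono (ℕₚ.≤⇒≤′ n≤K)) (s≤v K)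
    ... | inj₂ K≤n = ≤-trans (s≤v n) (antitone v v-decr ℕₚ.≤-refl (ℕₚ.≤⇒≤′ K≤n))

    b-small : ∀ ε → 0ℚ < ε → ∃[ N ] (∀ n → N ℕ.≤ n → b n ≤ ε)
    b-small ε 0<ε =
      let δ , 0<δ , Cδ≤ε = shrink (b K * B) ε (0≤* (0≤b K) 0≤B) 0<ε
          M , h = 1/suc-small δ 0<δ
      in suc (K ℕ.⊔ M) , λ { (suc k) (ℕ.s≤s p) → bound k (⊔ˡ {K} p) δ Cδ≤ε (h k (⊔ʳ {K} p)) }
      where
      open ℚR
      bound : ∀ k → K ℕ.≤ k → ∀ δ → b K * B * δ ≤ ε → 1/ fromℕ (suc k) ≤ δ → b (suc k) ≤ ε
      bound k K≤k δ Cδ≤ε h = begin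
        b (suc k)                        ≡⟨ b-suc k ⟩
        b k * (B * 1/ fromℕ (suc k))     ≡⟨ *-assoc (b k) B (1/ fromℕ (suc k)) ⟨
        b k * B * 1/ fromℕ (suc k)       ≤⟨ mono* (0≤* (0≤b K) 0≤B) (0≤1/suc k)
                                              (monoʳ 0≤B (antitone b b-decr ℕₚ.≤-refl (ℕₚ.≤⇒≤′ K≤k))) h ⟩
        b K * B * δ                      ≤⟨ Cδ≤ε ⟩
        ε                                ∎

    s-tail : ∀ ε → 0ℚ < ε → ∃[ N ] (∀ {m n} → N ℕ.≤ m → m ℕ.≤ n → s n ≤ s m + ε)
    s-tail ε 0<ε =
      let N , h = b-small (½ * ε) (0<½* 0<ε)
      in K ℕ.⊔ N , λ {m} {n} p m≤n → begin
        s n                    ≤⟨ s≤v n ⟩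
        v n                    ≤⟨ antitone v v-decr (⊔ˡ {K} p) (ℕₚ.≤⇒≤′ m≤n) ⟩
        s m + (b m + b m)      ≤⟨ +-monoʳ-≤ (s m) (+-mono-≤ (h m (⊔ʳ {K} p)) (h m (⊔ʳ {K} p))) ⟩
        s m + (½ * ε + ½ * ε)  ≡⟨ cong (λ t → s m + t) (halves ε) ⟩
        s m + ε                ∎
      where open ℚR

    ‖pow‖ : ∀ z → ‖ z ‖ ≤ B → ∀ k → ‖ pow z k ‖ ≤ powB k
    ‖pow‖ z h zero    = ≤-refl
    ‖pow‖ z h (suc k) = ≤-trans (‖⊗‖ z (pow z k)) (mono* 0≤B (0≤‖‖ (pow z k)) h (‖pow‖ z h k))

    ‖term‖ : ∀ z → ‖ z ‖ ≤ B → ∀ k → ‖ (invFactorial k ⊹ 0ℚ) ⊗ pow z k ‖ ≤ b k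
    ‖term‖ z h k = ≤-trans (‖⊗‖ (invFactorial k ⊹ 0ℚ) (pow z k))
      (subst (λ t → t * ‖ pow z k ‖ ≤ b k) (sym (‖invFactorial‖ k)) (monoˡ (0≤invFactorial k) (‖pow‖ z h k)))

    expℚ-tail : ∀ z → ‖ z ‖ ≤ B → ∀ {m n} → m ℕ.≤′ n → s m + ‖ expℚ n z ⊖ expℚ m z ‖ ≤ s n
    expℚ-tail z h {m} (ℕ.≤′-reflexive refl) = ≤-reflexive
      (trans (cong (λ t → s m + t) (‖⊖‖-self (expℚ m z))) (+-identityʳ (s m)))
    expℚ-tail z h {m} (ℕ.≤′-step {n} m≤n) = begin
      s m + ‖ (expℚ n z ⊕ t) ⊖ expℚ m z ‖         ≡⟨ cong (λ u → s m + ‖ u ‖) (⊕-⊖ (expℚ n z) t (expℚ m z)) ⟩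
      s m + ‖ (expℚ n z ⊖ expℚ m z) ⊕ t ‖         ≤⟨ +-monoʳ-≤ (s m) (‖⊕‖ (expℚ n z ⊖ expℚ m z) t) ⟩
      s m + (‖ expℚ n z ⊖ expℚ m z ‖ + ‖ t ‖)     ≡⟨ +-assoc (s m) (‖ expℚ n z ⊖ expℚ m z ‖) (‖ t ‖) ⟨
      s m + ‖ expℚ n z ⊖ expℚ m z ‖ + ‖ t ‖       ≤⟨ +-mono-≤ (expℚ-tail z h m≤n) (‖term‖ z h n) ⟩
      s n + b n                                   ∎
      where
      open ℚR
      t : ℚ[i]
      t = (invFactorial n ⊹ 0ℚ) ⊗ pow z n

    module _ (z w : ℚ[i]) (‖z‖≤B : ‖ z ‖ ≤ B) (‖w‖≤B : ‖ w ‖ ≤ B) where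
      d : ℚ
      d = ‖ z ⊖ w ‖

      0≤d : 0ℚ ≤ d
      0≤d = 0≤‖‖ (z ⊖ w)

      pow-lipschitz : ∀ k → ‖ pow z (suc k) ⊖ pow w (suc k) ‖ ≤ fromℕ (suc k) * powB k * d
      pow-lipschitz zero = begin
        ‖ (z ⊗ one) ⊖ (w ⊗ one) ‖      ≡⟨ cong ‖_‖ (cong₂ _⊖_ (⊗-one z) (⊗-one w)) ⟩
        d                              ≡⟨ *-identityˡ d ⟨
        1ℚ * d                         ∎
        where
        open ℚR
        one : ℚ[i]
        one = 1ℚ ⊹ 0ℚ
        open +-*-Solver
        ⊗-one : ∀ u → u ⊗ one ≡ u
        ⊗-one (a ⊹ b) = cong₂ _⊹_
          (solve 2 (λ a b → a :* con 1ℚ :+ :- (b :* con 0ℚ) := a) refl a b)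
          (solve 2 (λ a b → a :* con 0ℚ :+ b :* con 1ℚ := b) refl a b)
      pow-lipschitz (suc k) = begin
        ‖ (z ⊗ zᵏ) ⊖ (w ⊗ wᵏ) ‖                          ≡⟨ cong ‖_‖ (⊗-⊖ z zᵏ w wᵏ) ⟩
        ‖ (z ⊗ (zᵏ ⊖ wᵏ)) ⊕ ((z ⊖ w) ⊗ wᵏ) ‖             ≤⟨ ‖⊕‖ (z ⊗ (zᵏ ⊖ wᵏ)) ((z ⊖ w) ⊗ wᵏ) ⟩
        ‖ z ⊗ (zᵏ ⊖ wᵏ) ‖ + ‖ (z ⊖ w) ⊗ wᵏ ‖             ≤⟨ +-mono-≤ (‖⊗‖ z (zᵏ ⊖ wᵏ)) (‖⊗‖ (z ⊖ w) wᵏ) ⟩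
        ‖ z ‖ * ‖ zᵏ ⊖ wᵏ ‖ + d * ‖ wᵏ ‖                 ≤⟨ +-mono-≤ (mono* 0≤B (0≤‖‖ (zᵏ ⊖ wᵏ)) ‖z‖≤B (pow-lipschitz k))
                                                                   (monoˡ 0≤d (‖pow‖ w ‖w‖≤B (suc k))) ⟩
        B * (k' * powB k * d) + d * (B * powB k)         ≡⟨ solve 4 (λ B n p d → B :* (n :* p :* d) :+ d :* (B :* p)
                                                                       := (con 1ℚ :+ n) :* (B :* p) :* d) refl B k' (powB k) d ⟩
        (1ℚ + k') * (B * powB k) * d                     ≡⟨ cong (λ t → t * (B * powB k) * d) (fromℕ-+ 1 (suc k)) ⟨
        fromℕ (suc (suc k)) * powB (suc k) * d           ∎
        where
        open ℚR
        open +-*-Solver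
        zᵏ wᵏ : ℚ[i]
        zᵏ = pow z (suc k)
        wᵏ = pow w (suc k)
        k' : ℚ
        k' = fromℕ (suc k)

      term-lipschitz : ∀ k → ‖ ((invFactorial (suc k) ⊹ 0ℚ) ⊗ pow z (suc k)) ⊖ ((invFactorial (suc k) ⊹ 0ℚ) ⊗ pow w (suc k)) ‖ ≤ b k * d
      term-lipschitz k = begin
        ‖ (f ⊗ zᵏ) ⊖ (f ⊗ wᵏ) ‖                          ≡⟨ cong ‖_‖ (⊗-distrib-⊖ f zᵏ wᵏ) ⟩
        ‖ f ⊗ (zᵏ ⊖ wᵏ) ‖                                ≤⟨ ‖⊗‖ f (zᵏ ⊖ wᵏ) ⟩
        ‖ f ‖ * ‖ zᵏ ⊖ wᵏ ‖                              ≡⟨ cong (_* ‖ zᵏ ⊖ wᵏ ‖) (‖invFactorial‖ (suc k)) ⟩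
        invFactorial (suc k) * ‖ zᵏ ⊖ wᵏ ‖               ≤⟨ monoˡ (0≤invFactorial (suc k)) (pow-lipschitz k) ⟩
        invFactorial k * u * (k' * powB k * d)           ≡⟨ solve 5 (λ f u n p d → f :* u :* (n :* p :* d) := (n :* u) :* (f :* p :* d)) refl
                                                              (invFactorial k) u k' (powB k) d ⟩
        (k' * u) * (b k * d)                             ≡⟨ cong (_* (b k * d)) (*-inverseʳ k') ⟩
        1ℚ * (b k * d)                                   ≡⟨ *-identityˡ (b k * d) ⟩
        b k * d                                          ∎
        where
        open ℚR
        open +-*-Solver
        f zᵏ wᵏ : ℚ[i]
        f = invFactorial (suc k) ⊹ 0ℚ
        zᵏ = pow z (suc k)
        wᵏ = pow w (suc k)
        k' u : ℚ
        k' = fromℕ (suc k)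
        u = 1/ fromℕ (suc k)

      expℚ-lipschitz′ : ∀ n → ‖ expℚ (suc n) z ⊖ expℚ (suc n) w ‖ ≤ s n * d
      expℚ-lipschitz′ zero = ≤-reflexive (trans (‖⊖‖-self (expℚ 1 z)) (sym (*-zeroˡ d)))
      expℚ-lipschitz′ (suc n) = begin
        ‖ (expℚ (suc n) z ⊕ t) ⊖ (expℚ (suc n) w ⊕ u) ‖     ≡⟨ cong ‖_‖ (⊖-⊕ (expℚ (suc n) z) t (expℚ (suc n) w) u) ⟩
        ‖ (expℚ (suc n) z ⊖ expℚ (suc n) w) ⊕ (t ⊖ u) ‖     ≤⟨ ‖⊕‖ (expℚ (suc n) z ⊖ expℚ (suc n) w) (t ⊖ u) ⟩
        ‖ expℚ (suc n) z ⊖ expℚ (suc n) w ‖ + ‖ t ⊖ u ‖     ≤⟨ +-mono-≤ (expℚ-lipschitz′ n) (term-lipschitz n) ⟩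
        s n * d + b n * d                                   ≡⟨ *-distribʳ-+ d (s n) (b n) ⟨
        (s n + b n) * d                                     ∎
        where
        open ℚR
        t u : ℚ[i]
        t = (invFactorial (suc n) ⊹ 0ℚ) ⊗ pow z (suc n)
        u = (invFactorial (suc n) ⊹ 0ℚ) ⊗ pow w (suc n)

      expℚ-lipschitz : ∀ n → ‖ expℚ n z ⊖ expℚ n w ‖ ≤ S * d
      expℚ-lipschitz zero    = ≤-trans (≤-reflexive (‖⊖‖-self (0ℚ ⊹ 0ℚ))) (0≤* 0≤S 0≤d)
      expℚ-lipschitz (suc n) = ≤-trans (expℚ-lipschitz′ n) (monoʳ 0≤d (s-bounded n))

    expℚ-cauchy : ∀ ε → 0ℚ < ε → ∃[ N ] (∀ z → ‖ z ‖ ≤ B → ∀ m n → N ℕ.≤ m → N ℕ.≤ n → ‖ expℚ m z ⊖ expℚ n z ‖ ≤ ε)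
    expℚ-cauchy ε 0<ε =
      let N , h = s-tail ε 0<ε
          ordered : ∀ z → ‖ z ‖ ≤ B → ∀ m n → N ℕ.≤ m → m ℕ.≤ n → ‖ expℚ n z ⊖ expℚ m z ‖ ≤ ε
          ordered z ‖z‖≤B m n N≤m m≤n = cancel (s m) (≤-trans (expℚ-tail z ‖z‖≤B (ℕₚ.≤⇒≤′ m≤n)) (h N≤m m≤n))
      in N , λ z ‖z‖≤B m n N≤m N≤n → total z m n (ordered z ‖z‖≤B m n N≤m) (ordered z ‖z‖≤B n m N≤n)
      where
      cancel : ∀ a {p q} → a + p ≤ a + q → p ≤ q
      cancel a {p} {q} h = subst₂ _≤_ (lemma p) (lemma q) (+-monoʳ-≤ (- a) h)
        where
        open +-*-Solver
        lemma : ∀ p → - a + (a + p) ≡ p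
        lemma p = solve 2 (λ a p → :- a :+ (a :+ p) := p) refl a p
      total : ∀ z m n → (m ℕ.≤ n → ‖ expℚ n z ⊖ expℚ m z ‖ ≤ ε) → (n ℕ.≤ m → ‖ expℚ m z ⊖ expℚ n z ‖ ≤ ε) →
              ‖ expℚ m z ⊖ expℚ n z ‖ ≤ ε
      total z m n f g with ℕₚ.≤-total m n
      ... | inj₁ m≤n = subst (_≤ ε) (‖⊖‖-sym (expℚ n z) (expℚ m z)) (f m≤n)
      ... | inj₂ n≤m = g n≤m

    expℚ-close : ∀ ε → 0ℚ < ε → ∃[ N ] ∃[ δ ] 0ℚ < δ × (∀ m n → N ℕ.≤ m → N ℕ.≤ n →
                 ∀ z w → ‖ z ‖ ≤ B → ‖ w ‖ ≤ B → ‖ z ⊖ w ‖ ≤ δ → ‖ expℚ m z ⊖ expℚ n w ‖ ≤ ε)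
    expℚ-close ε 0<ε =
      let N , h = expℚ-cauchy (½ * ε) (0<½* 0<ε)
          δ , 0<δ , Sδ≤ = shrink S (½ * ε) 0≤S (0<½* 0<ε)
      in N , δ , 0<δ , λ m n p q z w ‖z‖≤B ‖w‖≤B zw≤δ → begin
        ‖ expℚ m z ⊖ expℚ n w ‖                                ≤⟨ ‖⊖‖-triangle (expℚ m z) (expℚ n z) (expℚ n w) ⟩
        ‖ expℚ m z ⊖ expℚ n z ‖ + ‖ expℚ n z ⊖ expℚ n w ‖      ≤⟨ +-mono-≤ (h z ‖z‖≤B m n p q)
                                                                 (≤-trans (expℚ-lipschitz z w ‖z‖≤B ‖w‖≤B n)
                                                                   (≤-trans (monoˡ 0≤S zw≤δ) Sδ≤)) ⟩
        ½ * ε + ½ * ε                                          ≡⟨ halves ε ⟩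
        ε                                                      ∎
      where open ℚR

  approx-bounded : ∀ z → ∃[ β ] ∃[ N ] (∀ n → N ℕ.≤ n → ‖ approx z n ‖ ≤ fromℕ β)
  approx-bounded z =
    let A , 0≤A , M , a = eventually-bounded (re z)
        B , 0≤B , N , b = eventually-bounded (im z)
        β , h = archimedean (A + B)
    in β , M ℕ.⊔ N , λ n p → ≤-trans (+-mono-≤ (a n (⊔ˡ {M} p)) (b n (⊔ʳ {M} p))) h

  approx-cauchy : ∀ z ε → 0ℚ < ε → ∃[ N ] (∀ m n → N ℕ.≤ m → N ℕ.≤ n → ‖ approx z m ⊖ approx z n ‖ ≤ ε)
  approx-cauchy z ε 0<ε =
    let M , f = cauchy (re z) (½ * ε) (0<½* 0<ε)
        N , g = cauchy (im z) (½ * ε) (0<½* 0<ε)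
    in M ℕ.⊔ N , λ m n p q → ≤-trans
      (+-mono-≤ (f m n (⊔ˡ {M} p) (⊔ˡ {M} q)) (g m n (⊔ʳ {M} p) (⊔ʳ {M} q)))
      (≤-reflexive (halves ε))

  exp-cauchy : ∀ z ε → 0ℚ < ε → ∃[ N ] (∀ m n → N ℕ.≤ m → N ℕ.≤ n →
               ‖ expℚ m (approx z m) ⊖ expℚ n (approx z n) ‖ ≤ ε)
  exp-cauchy z ε 0<ε =
    let β , L , bd = approx-bounded z
        M , δ , 0<δ , close = Majorant.expℚ-close β ε 0<ε
        N , h = approx-cauchy z δ 0<δ
    in L ℕ.⊔ (M ℕ.⊔ N) , λ m n p q →
      close m n (⊔ˡ {M} (⊔ʳ {L} p)) (⊔ˡ {M} (⊔ʳ {L} q)) (approx z m) (approx z n)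
        (bd m (⊔ˡ {L} p)) (bd n (⊔ˡ {L} q)) (h m n (⊔ʳ {M} (⊔ʳ {L} p)) (⊔ʳ {M} (⊔ʳ {L} q)))

open exp-Lemmas

abstract
  re-exp-cauchy : ∀ z → IsCauchy (λ n → reℚ (expℚ n (approx z n)))
  re-exp-cauchy z ε 0<ε = let N , h = exp-cauchy z ε 0<ε in N , λ m n p q →
    ≤-trans (∣re∣≤ (expℚ m (approx z m) ⊖ expℚ n (approx z n))) (h m n p q)

  im-exp-cauchy : ∀ z → IsCauchy (λ n → imℚ (expℚ n (approx z n)))
  im-exp-cauchy z ε 0<ε = let N , h = exp-cauchy z ε 0<ε in N , λ m n p q →
    ≤-trans (∣im∣≤ (expℚ m (approx z m) ⊖ expℚ n (approx z n))) (h m n p q)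

-- The limit of Σ_{k<n} zₙᵏ / k!, where zₙ is the n-th rational
-- approximation of z. By exp-series below, this is Σ_k zᵏ / k!.
exp : ℂ → ℂ
exp z = mkℝ (λ n → reℚ (expℚ n (approx z n))) (re-exp-cauchy z)
     +i mkℝ (λ n → imℚ (expℚ n (approx z n))) (im-exp-cauchy z)

_^ᶜ_ : ℂ → ℕ → ℂ
z ^ᶜ zero  = 1ᶜ
z ^ᶜ suc k = z *ᶜ (z ^ᶜ k)

expSeries : ℂ → ℕ → ℂ
expSeries z zero    = 0ᶜ
expSeries z (suc n) = expSeries z n +ᶜ ofℝ (ofℚ (invFactorial n)) *ᶜ (z ^ᶜ n)

_⟶_ : (ℕ → ℂ) → ℂ → Set
s ⟶ z = ∀ ε → 0ℚ < ε → ∃[ N ] (∀ n → N ℕ.≤ n →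
         ∃[ M ] (∀ k → M ℕ.≤ k → ‖ approx (s n) k ⊖ approx z k ‖ ≤ ε))

exp-series : ∀ z → expSeries z ⟶ exp z
exp-series z ε 0<ε =
  let β , L , bd = approx-bounded z
      M , close = Majorant.expℚ-cauchy β ε 0<ε
  in M , λ n M≤n → L ℕ.⊔ M , λ k p →
    subst (λ t → ‖ t ⊖ expℚ k (approx z k) ‖ ≤ ε) (sym (approx-expSeries n k))
      (close (approx z k) (bd k (⊔ˡ {L} p)) n k M≤n (⊔ʳ {L} p))
  where
  approx-pow : ∀ n k → approx (z ^ᶜ n) k ≡ pow (approx z k) n
  approx-pow zero    k = refl
  approx-pow (suc n) k = cong (approx z k ⊗_) (approx-pow n k)
  approx-expSeries : ∀ n k → approx (expSeries z n) k ≡ expℚ n (approx z k)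
  approx-expSeries zero    k = refl
  approx-expSeries (suc n) k = cong₂ (λ s t → s ⊕ ((invFactorial n ⊹ 0ℚ) ⊗ t)) (approx-expSeries n k) (approx-pow n k)

cosʳ : ℝ → ℝ
cosʳ x = re (exp (𝕚 *ᶜ ofℝ x))

-- Determines π uniquely: π/2 is the least positive zero of the cosine.
record IsPi (π : ℝ) : Set where
  field
    0<π      : 0ʳ <ʳ π
    cos[π/2] : cosʳ (ofℚ ½ *ʳ π) ≈ʳ 0ʳ
    least    : ∀ x → 0ʳ <ʳ x → cosʳ x ≈ʳ 0ʳ → ofℚ ½ *ʳ π ≤ʳ x

-- Determines ℓ = log x uniquely, exp being injective on ℝ.
IsLog : ℝ → ℝ → Set
IsLog x ℓ = exp (ofℝ ℓ) ≈ ofℝ x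

φ : ℝ
φ = ofℚ ½ *ʳ (1ʳ +ʳ √5)

abstract
  √5#0 : ofℝ √5 #0
  √5#0 = 1ℚ , positive⁻¹ 1ℚ , 0 , λ n _ → lower n
    where
    open ℚR
    lower : ∀ n → 0ℚ + 1ℚ ≤ √5-seq n * √5-seq n + 0ℚ * 0ℚ
    lower n = begin
      0ℚ + 1ℚ                           ≡⟨⟩
      1ℚ * 1ℚ                           ≤⟨ mono* (0≤√5 n) 0≤1 (1≤√5 n) (1≤√5 n) ⟩
      √5-seq n * √5-seq n               ≡⟨ +-identityʳ (√5-seq n * √5-seq n) ⟨
      √5-seq n * √5-seq n + 0ℚ          ≡⟨⟩
      √5-seq n * √5-seq n + 0ℚ * 0ℚ     ∎

-- ω-cong: a function on ℂ has to respect the setoid equality.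
record IsCompleteNFe (ω : ℂ → ℂ) : Set where
  field
    ω-cong     : ∀ {m n} → m ≈ n → ω m ≈ ω n
    recurrence : ∀ n → ω n ≈ ω (n -ᶜ 2ᶜ) -ᶜ ω (n -ᶜ 1ᶜ)

module Powers (π logφ : ℝ) where

  infix 9 [-1]^_ φ^_ [-φ]^_

  [-1]^_ φ^_ [-φ]^_ : ℂ → ℂ
  [-1]^ n = exp (𝕚 *ᶜ ofℝ π *ᶜ n)
  φ^ n    = exp (n *ᶜ ofℝ logφ)
  [-φ]^ n = [-1]^ n *ᶜ φ^ n

  Θ : ℂ → ℂ
  Θ n = (φ^ n -ᶜ [-φ]^ (-ᶜ n)) /ᶜ ofℝ √5 [ √5#0 ]

  Ω : ℂ → ℂ → ℂ → ℂ
  Ω η γ n = η *ᶜ [-1]^ (n -ᶜ 1ᶜ) *ᶜ Θ n +ᶜ γ *ᶜ [-1]^ n *ᶜ Θ (n -ᶜ 1ᶜ) *ᶜ ofℝ φ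

  -- division takes evidence that the divisor is apart from zero
  Φ : (∀ n → φ^ n #0) → ℂ → ℂ
  Φ φ^#0 n = 1ᶜ /ᶜ φ^ (n -ᶜ 1ᶜ) [ φ^#0 (n -ᶜ 1ᶜ) ]

{-# OPTIONS --safe #-}
module Submission where

-- Multiplying the truncated series of exp z and exp w gives the truncated
-- series of exp (z + w) plus an error term that vanishes in the limit, so
-- n ↦ φⁿ and n ↦ (-1)ⁿ are exponential. Writing h = exp (iπ/2), cos (π/2) = 0
-- says that the conjugate of h is -h, while h times its conjugate is exp 0 = 1;
-- hence exp (iπ) = h² = -1. Thus (-1)ⁿ⁻¹ = -(-1)ⁿ, the terms of Ω in φⁿ
-- cancel, and φ⁻ⁿ (1 + φ²) / √5 = φ⁻ⁿ φ = Φ n remains, because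
-- 1 + φ² = √5 φ. The recurrence for Φ is φ² = φ + 1.

open import Defs
open import Algebra.Core using (Op₁; Op₂)
open import Algebra.Bundles using (CommutativeRing)
import Algebra.Definitions
open import Algebra.Structures using (IsCommutativeRing)
import Algebra.Solver.Ring as RingSolver
import Algebra.Solver.Ring.AlmostCommutativeRing as ACR
open import Data.Maybe.Base using (Maybe; just; nothing)
open import Data.Nat.Base as ℕ using (ℕ; zero; suc)
import Data.Nat.Properties as ℕₚ
open import Data.Product.Base using (Σ-syntax; ∃-syntax; _×_; _,_; proj₁; proj₂)
open import Data.Rational.Base
open import Data.Rational.Properties
open import Data.Rational.Solver using (module +-*-Solver)
open import Data.Sum.Base using (inj₁; inj₂)
open import Function.Base using (_∘_; const)
open import Level using (0ℓ)
open import Relation.Binary.Core using (Rel)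
open import Relation.Binary.PropositionalEquality
  using (_≡_; refl; sym; trans; cong; cong₂; subst; isEquivalence; module ≡-Reasoning)
open import Relation.Binary.Structures using (IsEquivalence)
import Relation.Binary.Reasoning.Setoid as ≈-Reasoning
open import Relation.Nullary using (yes; no)

open ℚ-Lemmas
open ℝ-Lemmas
open recip-Lemmas
open √5-Properties
open exp-Lemmas

-- The n-th approximant of `exp z` is the n-th partial sum at the n-th rational approximation of z.
-- Each law of `exp` therefore comes from a fact about finite sums over `ℚ[i]` at one common index:
-- an exact identity, or an estimate uniform over all arguments of norm at most a natural number.
-- For the functional equation, the exact part replaces the binomial theorem by a recursion: in
-- generating functions `θ` is x d/dx and `expTerm z` is e^(zx). The error term is the part i + j >
-- n of the square i, j ≤ n. Grouped by i, it pairs terms of the series of z with tails of the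
-- series of w: for small i the tails are small, for large i the terms have a small sum. The sign of
-- sin (π/2) never enters, since h = i and h = -i have the same square.

private
  module ℚR = ≤-Reasoning

-- The Gaussian rationals

infix 8 ⊝_

⊝_ : ℚ[i] → ℚ[i]
⊝ (a ⊹ b) = (- a) ⊹ (- b)

𝟘 𝟙 : ℚ[i]
𝟘 = 0ℚ ⊹ 0ℚ
𝟙 = 1ℚ ⊹ 0ℚ

module ℚ[i]-Laws where
  open +-*-Solver

  ⊕-assoc : ∀ x y z → (x ⊕ y) ⊕ z ≡ x ⊕ (y ⊕ z)
  ⊕-assoc (a ⊹ b) (c ⊹ d) (e ⊹ f) = cong₂ _⊹_ (+-assoc a c e) (+-assoc b d f)

  ⊕-comm : ∀ x y → x ⊕ y ≡ y ⊕ x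
  ⊕-comm (a ⊹ b) (c ⊹ d) = cong₂ _⊹_ (+-comm a c) (+-comm b d)

  ⊕-identityˡ : ∀ x → 𝟘 ⊕ x ≡ x
  ⊕-identityˡ (a ⊹ b) = cong₂ _⊹_ (+-identityˡ a) (+-identityˡ b)

  ⊕-inverseˡ : ∀ x → ⊝ x ⊕ x ≡ 𝟘
  ⊕-inverseˡ (a ⊹ b) = cong₂ _⊹_ (+-inverseˡ a) (+-inverseˡ b)

  ⊗-assoc : ∀ x y z → (x ⊗ y) ⊗ z ≡ x ⊗ (y ⊗ z)
  ⊗-assoc (a ⊹ b) (c ⊹ d) (e ⊹ f) = cong₂ _⊹_
    (solve 6 (λ a b c d e f → (a :* c :- b :* d) :* e :- (a :* d :+ b :* c) :* f
      := a :* (c :* e :- d :* f) :- b :* (c :* f :+ d :* e)) refl a b c d e f)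
    (solve 6 (λ a b c d e f → (a :* c :- b :* d) :* f :+ (a :* d :+ b :* c) :* e
      := a :* (c :* f :+ d :* e) :+ b :* (c :* e :- d :* f)) refl a b c d e f)

  ⊗-comm : ∀ x y → x ⊗ y ≡ y ⊗ x
  ⊗-comm (a ⊹ b) (c ⊹ d) = cong₂ _⊹_
    (solve 4 (λ a b c d → a :* c :- b :* d := c :* a :- d :* b) refl a b c d)
    (solve 4 (λ a b c d → a :* d :+ b :* c := c :* b :+ d :* a) refl a b c d)

  ⊗-identityˡ : ∀ x → 𝟙 ⊗ x ≡ x
  ⊗-identityˡ (a ⊹ b) = cong₂ _⊹_
    (solve 2 (λ a b → con 1ℚ :* a :- con 0ℚ :* b := a) refl a b)
    (solve 2 (λ a b → con 1ℚ :* b :+ con 0ℚ :* a := b) refl a b)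

  ⊗-distribˡ-⊕ : ∀ x y z → x ⊗ (y ⊕ z) ≡ x ⊗ y ⊕ x ⊗ z
  ⊗-distribˡ-⊕ (a ⊹ b) (c ⊹ d) (e ⊹ f) = cong₂ _⊹_
    (solve 6 (λ a b c d e f → a :* (c :+ e) :- b :* (d :+ f)
      := (a :* c :- b :* d) :+ (a :* e :- b :* f)) refl a b c d e f)
    (solve 6 (λ a b c d e f → a :* (d :+ f) :+ b :* (c :+ e)
      := (a :* d :+ b :* c) :+ (a :* f :+ b :* e)) refl a b c d e f)

  ⊗-distribʳ-⊕ : ∀ x y z → (y ⊕ z) ⊗ x ≡ y ⊗ x ⊕ z ⊗ x
  ⊗-distribʳ-⊕ x y z = trans (⊗-comm (y ⊕ z) x)
    (trans (⊗-distribˡ-⊕ x y z) (cong₂ _⊕_ (⊗-comm x y) (⊗-comm x z)))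

open ℚ[i]-Laws

module _ {a ℓ} {A : Set a} {_∼_ : Rel A ℓ} {_∙_ _◦_ : Op₂ A} {inv : Op₁ A} {zer one : A} where
  open Algebra.Definitions _∼_

  mkIsCommutativeRing : IsEquivalence _∼_ → Congruent₂ _∙_ → Congruent₂ _◦_ → Congruent₁ inv →
    Associative _∙_ → Commutative _∙_ → LeftIdentity zer _∙_ → LeftInverse zer inv _∙_ →
    Associative _◦_ → Commutative _◦_ → LeftIdentity one _◦_ → _◦_ DistributesOverˡ _∙_ →
    IsCommutativeRing _∼_ _∙_ _◦_ inv zer one
  mkIsCommutativeRing ≈-equiv ∙-cong ◦-cong inv-cong ∙-assoc ∙-comm ∙-idˡ ∙-invˡ ◦-assoc ◦-comm ◦-idˡ distribˡ = record
    { isRing = record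
      { +-isAbelianGroup = record
        { isGroup = record
          { isMonoid = record
            { isSemigroup = record
              { isMagma = record { isEquivalence = ≈-equiv ; ∙-cong = ∙-cong }
              ; assoc = ∙-assoc }
            ; identity = ∙-idˡ , λ x → ∼-trans (∙-comm _ _) (∙-idˡ x) }
          ; inverse = ∙-invˡ , λ x → ∼-trans (∙-comm _ _) (∙-invˡ x)
          ; ⁻¹-cong = inv-cong }
        ; comm = ∙-comm }
      ; *-cong = ◦-cong
      ; *-assoc = ◦-assoc
      ; *-identity = ◦-idˡ , λ x → ∼-trans (◦-comm _ _) (◦-idˡ x)
      ; distrib = distribˡ , λ x y z → ∼-trans (◦-comm _ _)
          (∼-trans (distribˡ x y z) (∙-cong (◦-comm _ _) (◦-comm _ _))) }
    ; *-comm = ◦-comm }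
    where open IsEquivalence ≈-equiv renaming (trans to ∼-trans)

ℚ[i]-commutativeRing : CommutativeRing 0ℓ 0ℓ
ℚ[i]-commutativeRing = record
  { isCommutativeRing = mkIsCommutativeRing {inv = ⊝_} {𝟘} {𝟙} isEquivalence (cong₂ _⊕_) (cong₂ _⊗_) (cong ⊝_)
      ⊕-assoc ⊕-comm ⊕-identityˡ ⊕-inverseˡ ⊗-assoc ⊗-comm ⊗-identityˡ ⊗-distribˡ-⊕ }

_≟ⁱ_ : (x y : ℚ[i]) → Maybe (x ≡ y)
(a ⊹ b) ≟ⁱ (c ⊹ d) with a ≟ c | b ≟ d
... | yes p | yes q = just (cong₂ _⊹_ p q)
... | _     | _     = nothing

private
  ℚ[i]-acr = ACR.fromCommutativeRing ℚ[i]-commutativeRing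

module ℚ[i]-Solver = RingSolver (CommutativeRing.rawRing ℚ[i]-commutativeRing)
  ℚ[i]-acr (ACR.-raw-almostCommutative⟶ ℚ[i]-acr) _≟ⁱ_

-- The complex numbers as a commutative ring

infix 4 _≋_

-- _≈_ unfolds to a pair of Π-types, from which Agda cannot infer the two
-- numbers; wrapping it in a record restores inference.
record _≋_ (z w : ℂ) : Set where
  constructor close
  field
    dist : ∀ ε → 0ℚ < ε → ∃[ N ] (∀ n → N ℕ.≤ n → ‖ approx z n ⊖ approx w n ‖ ≤ ε)
open _≋_

≋⇒≈ : ∀ {z w} → z ≋ w → z ≈ w
≋⇒≈ {z} {w} (close h) =
  (λ ε p → proj₁ (h ε p) , λ n q → ≤-trans (∣re∣≤ (approx z n ⊖ approx w n)) (proj₂ (h ε p) n q)) ,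
  (λ ε p → proj₁ (h ε p) , λ n q → ≤-trans (∣im∣≤ (approx z n ⊖ approx w n)) (proj₂ (h ε p) n q))

≈⇒≋ : ∀ {z w} → z ≈ w → z ≋ w
≈⇒≋ (f , g) = close λ ε 0<ε →
  let M , a = f (½ * ε) (0<½* 0<ε)
      N , b = g (½ * ε) (0<½* 0<ε)
  in M ℕ.⊔ N , λ n p → ≤-trans (+-mono-≤ (a n (⊔ˡ {M} p)) (b n (⊔ʳ {M} p))) (≤-reflexive (halves ε))

≡⇒‖⊖‖≤ : ∀ {x y ε} → 0ℚ < ε → x ≡ y → ‖ x ⊖ y ‖ ≤ ε
≡⇒‖⊖‖≤ {x} 0<ε refl = ≤-trans (≤-reflexive (‖⊖‖-self x)) (<⇒≤ 0<ε)

-- The freedom in N matters where early approximants are wrong: the empty partial sum of `exp`, and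
-- the junk value of `recipℚ` at 0.
eventually-≡⇒≋ : ∀ {z w} N → (∀ n → N ℕ.≤ n → approx z n ≡ approx w n) → z ≋ w
eventually-≡⇒≋ N h = close λ ε 0<ε → N , λ n p → ≡⇒‖⊖‖≤ 0<ε (h n p)

pointwise : ∀ {z w} → (∀ n → approx z n ≡ approx w n) → z ≋ w
pointwise h = eventually-≡⇒≋ 0 λ n _ → h n

≋-refl : ∀ {z} → z ≋ z
≋-refl = pointwise λ _ → refl

≋-sym : ∀ {z w} → z ≋ w → w ≋ z
≋-sym {z} {w} h = close λ ε 0<ε → let N , a = dist h ε 0<ε in
  N , λ n p → subst (_≤ ε) (‖⊖‖-sym (approx z n) (approx w n)) (a n p)

≋-trans : ∀ {z v w} → z ≋ v → v ≋ w → z ≋ w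
≋-trans {z} {v} {w} f g = close λ ε 0<ε →
  let M , a = dist f (½ * ε) (0<½* 0<ε)
      N , b = dist g (½ * ε) (0<½* 0<ε)
  in M ℕ.⊔ N , λ n p → ≤-trans (‖⊖‖-triangle (approx z n) (approx v n) (approx w n))
    (≤-trans (+-mono-≤ (a n (⊔ˡ {M} p)) (b n (⊔ʳ {M} p))) (≤-reflexive (halves ε)))

+ᶜ-cong : ∀ {x y u v} → x ≋ y → u ≋ v → x +ᶜ u ≋ y +ᶜ v
+ᶜ-cong {x} {y} {u} {v} f g = close λ ε 0<ε →
  let M , a = dist f (½ * ε) (0<½* 0<ε)
      N , b = dist g (½ * ε) (0<½* 0<ε)
  in M ℕ.⊔ N , λ n p → begin
    ‖ (approx x n ⊕ approx u n) ⊖ (approx y n ⊕ approx v n) ‖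
      ≡⟨ cong ‖_‖ (⊖-⊕ (approx x n) (approx u n) (approx y n) (approx v n)) ⟩
    ‖ (approx x n ⊖ approx y n) ⊕ (approx u n ⊖ approx v n) ‖
      ≤⟨ ‖⊕‖ (approx x n ⊖ approx y n) (approx u n ⊖ approx v n) ⟩
    ‖ approx x n ⊖ approx y n ‖ + ‖ approx u n ⊖ approx v n ‖
      ≤⟨ +-mono-≤ (a n (⊔ˡ {M} p)) (b n (⊔ʳ {M} p)) ⟩
    ½ * ε + ½ * ε
      ≡⟨ halves ε ⟩
    ε ∎
  where open ℚR

-- From xu - yv = x(u - v) + (x - y)v, where the approximants of x and v are eventually bounded.
*ᶜ-cong : ∀ {x y u v} → x ≋ y → u ≋ v → x *ᶜ u ≋ y *ᶜ v
*ᶜ-cong {x} {y} {u} {v} f g = close λ ε 0<ε →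
  let α , K , bx = approx-bounded x
      β , L , bv = approx-bounded v
      δ , 0<δ , αδ≤ = shrink (fromℕ α) (½ * ε) (0≤fromℕ α) (0<½* 0<ε)
      η , 0<η , βη≤ = shrink (fromℕ β) (½ * ε) (0≤fromℕ β) (0<½* 0<ε)
      M , a = dist f η 0<η
      N , b = dist g δ 0<δ
  in (K ℕ.⊔ L) ℕ.⊔ (M ℕ.⊔ N) , λ n p →
    bound (approx x n) (approx u n) (approx y n) (approx v n) {fromℕ α} {fromℕ β} {δ} {η} (0≤fromℕ α) (<⇒≤ 0<η)
      (bx n (⊔ˡ {K} (⊔ˡ {K ℕ.⊔ L} p))) (bv n (⊔ʳ {K} (⊔ˡ {K ℕ.⊔ L} p)))
      (a n (⊔ˡ {M} (⊔ʳ {K ℕ.⊔ L} p))) (b n (⊔ʳ {M} (⊔ʳ {K ℕ.⊔ L} p))) αδ≤ βη≤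
  where
  open ℚR
  bound : ∀ x u y v {A B δ η ε} → 0ℚ ≤ A → 0ℚ ≤ η → ‖ x ‖ ≤ A → ‖ v ‖ ≤ B → ‖ x ⊖ y ‖ ≤ η → ‖ u ⊖ v ‖ ≤ δ →
          A * δ ≤ ½ * ε → B * η ≤ ½ * ε → ‖ (x ⊗ u) ⊖ (y ⊗ v) ‖ ≤ ε
  bound x u y v {A} {B} {δ} {η} {ε} 0≤A 0≤η x≤A v≤B xy≤η uv≤δ Aδ≤ Bη≤ = begin
    ‖ (x ⊗ u) ⊖ (y ⊗ v) ‖                  ≡⟨ cong ‖_‖ (⊗-⊖ x u y v) ⟩
    ‖ (x ⊗ (u ⊖ v)) ⊕ ((x ⊖ y) ⊗ v) ‖      ≤⟨ ‖⊕‖ (x ⊗ (u ⊖ v)) ((x ⊖ y) ⊗ v) ⟩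
    ‖ x ⊗ (u ⊖ v) ‖ + ‖ (x ⊖ y) ⊗ v ‖      ≤⟨ +-mono-≤ (‖⊗‖ x (u ⊖ v)) (‖⊗‖ (x ⊖ y) v) ⟩
    ‖ x ‖ * ‖ u ⊖ v ‖ + ‖ x ⊖ y ‖ * ‖ v ‖  ≤⟨ +-mono-≤ (mono* 0≤A (0≤‖‖ (u ⊖ v)) x≤A uv≤δ) (mono* 0≤η (0≤‖‖ v) xy≤η v≤B) ⟩
    A * δ + η * B                          ≡⟨ cong (λ t → A * δ + t) (*-comm η B) ⟩
    A * δ + B * η                          ≤⟨ +-mono-≤ Aδ≤ Bη≤ ⟩
    ½ * ε + ½ * ε                          ≡⟨ halves ε ⟩
    ε                                      ∎

-ᶜ-cong : ∀ {x y} → x ≋ y → -ᶜ x ≋ -ᶜ y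
-ᶜ-cong {x} {y} h = close λ ε 0<ε → let N , a = dist h ε 0<ε in
  N , λ n p → subst (_≤ ε) (sym (‖⊝⊖⊝‖ (approx x n) (approx y n))) (a n p)
  where
  ‖⊝⊖⊝‖ : ∀ z w → ‖ ⊝ z ⊖ ⊝ w ‖ ≡ ‖ z ⊖ w ‖
  ‖⊝⊖⊝‖ (a ⊹ b) (c ⊹ d) = cong₂ _+_ (dist-neg a c) (dist-neg b d)

ℂ-commutativeRing : CommutativeRing 0ℓ 0ℓ
ℂ-commutativeRing = record
  { Carrier = ℂ ; _≈_ = _≋_ ; _+_ = _+ᶜ_ ; _*_ = _*ᶜ_ ; -_ = -ᶜ_ ; 0# = 0ᶜ ; 1# = 1ᶜ
  ; isCommutativeRing = mkIsCommutativeRing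
      (record { refl = ≋-refl ; sym = ≋-sym ; trans = ≋-trans })
      +ᶜ-cong *ᶜ-cong
      -ᶜ-cong
      (λ x y z → pointwise λ n → ⊕-assoc (approx x n) (approx y n) (approx z n))
      (λ x y → pointwise λ n → ⊕-comm (approx x n) (approx y n))
      (λ x → pointwise λ n → ⊕-identityˡ (approx x n))
      (λ x → pointwise λ n → ⊕-inverseˡ (approx x n))
      (λ x y z → pointwise λ n → ⊗-assoc (approx x n) (approx y n) (approx z n))
      (λ x y → pointwise λ n → ⊗-comm (approx x n) (approx y n))
      (λ x → pointwise λ n → ⊗-identityˡ (approx x n))
      (λ x y z → pointwise λ n → ⊗-distribˡ-⊕ (approx x n) (approx y n) (approx z n)) }

-- Coefficients for the ring solver over ℂ: their equality is decidable, so constants such as ½, 2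
-- and 5 are computed with instead of being treated as variables.
ofℚ[i] : ℚ[i] → ℂ
ofℚ[i] (a ⊹ b) = ofℚ a +i ofℚ b

private
  ℂ-acr = ACR.fromCommutativeRing ℂ-commutativeRing

  ofℚ[i]-morphism : CommutativeRing.rawRing ℚ[i]-commutativeRing ACR.-Raw-AlmostCommutative⟶ ℂ-acr
  ofℚ[i]-morphism = record
    { ⟦_⟧    = ofℚ[i]
    ; +-homo = λ _ _ → pointwise λ _ → refl
    ; *-homo = λ _ _ → pointwise λ _ → refl
    ; -‿homo = λ _ → pointwise λ _ → refl
    ; 0-homo = pointwise λ _ → refl
    ; 1-homo = pointwise λ _ → refl }

  _≟ᶜ_ : (x y : ℚ[i]) → Maybe (ofℚ[i] x ≋ ofℚ[i] y)
  x ≟ᶜ y with x ≟ⁱ y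
  ... | just refl = just ≋-refl
  ... | nothing   = nothing

module ℂ-Solver = RingSolver (CommutativeRing.rawRing ℚ[i]-commutativeRing) ℂ-acr ofℚ[i]-morphism _≟ᶜ_

-- The functional equation of exp

infixl 7 _⋆_

-- the Cauchy product Σ_{i≤n} f i ⊗ g (n - i)
_⋆_ : (ℕ → ℚ[i]) → (ℕ → ℚ[i]) → ℕ → ℚ[i]
(f ⋆ g) zero    = f 0 ⊗ g 0
(f ⋆ g) (suc n) = f 0 ⊗ g (suc n) ⊕ ((f ∘ suc) ⋆ g) n

Σ< : (ℕ → ℚ[i]) → ℕ → ℚ[i]
Σ< f zero    = 𝟘
Σ< f (suc n) = Σ< f n ⊕ f n

expTerm : ℚ[i] → ℕ → ℚ[i]
expTerm z k = (invFactorial k ⊹ 0ℚ) ⊗ pow z k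

expℚ≡Σ< : ∀ z n → expℚ n z ≡ Σ< (expTerm z) n
expℚ≡Σ< z zero    = refl
expℚ≡Σ< z (suc n) = cong (_⊕ expTerm z n) (expℚ≡Σ< z n)

cast : ℕ → ℚ[i]
cast n = fromℕ n ⊹ 0ℚ

-- the Euler operator, a derivation for ⋆
θ : (ℕ → ℚ[i]) → ℕ → ℚ[i]
θ f n = cast n ⊗ f n

module Convolution where
  open ≡-Reasoning
  open ℚ[i]-Solver

  ⋆-cong : ∀ {f f′ g g′} → (∀ k → f k ≡ f′ k) → (∀ k → g k ≡ g′ k) → ∀ n → (f ⋆ g) n ≡ (f′ ⋆ g′) n
  ⋆-cong p q zero    = cong₂ _⊗_ (p 0) (q 0)
  ⋆-cong p q (suc n) = cong₂ _⊕_ (cong₂ _⊗_ (p 0) (q (suc n))) (⋆-cong (λ k → p (suc k)) q n)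

  ⋆-distribʳ : ∀ f g h n → ((λ k → f k ⊕ g k) ⋆ h) n ≡ (f ⋆ h) n ⊕ (g ⋆ h) n
  ⋆-distribʳ f g h zero    = ⊗-distribʳ-⊕ (h 0) (f 0) (g 0)
  ⋆-distribʳ f g h (suc n) = trans (cong ((f 0 ⊕ g 0) ⊗ h (suc n) ⊕_) (⋆-distribʳ (f ∘ suc) (g ∘ suc) h n))
    (solve 5 (λ a b c x y → (a :+ b) :* c :+ (x :+ y) := (a :* c :+ x) :+ (b :* c :+ y)) refl
      (f 0) (g 0) (h (suc n)) (((f ∘ suc) ⋆ h) n) (((g ∘ suc) ⋆ h) n))

  ⋆-distribˡ : ∀ f g h n → (f ⋆ (λ k → g k ⊕ h k)) n ≡ (f ⋆ g) n ⊕ (f ⋆ h) n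
  ⋆-distribˡ f g h zero    = ⊗-distribˡ-⊕ (f 0) (g 0) (h 0)
  ⋆-distribˡ f g h (suc n) = trans (cong (f 0 ⊗ (g (suc n) ⊕ h (suc n)) ⊕_) (⋆-distribˡ (f ∘ suc) g h n))
    (solve 5 (λ a b c x y → a :* (b :+ c) :+ (x :+ y) := (a :* b :+ x) :+ (a :* c :+ y)) refl
      (f 0) (g (suc n)) (h (suc n)) (((f ∘ suc) ⋆ g) n) (((f ∘ suc) ⋆ h) n))

  ⋆-scaleˡ : ∀ c f g n → ((λ k → c ⊗ f k) ⋆ g) n ≡ c ⊗ (f ⋆ g) n
  ⋆-scaleˡ c f g zero    = ⊗-assoc c (f 0) (g 0)
  ⋆-scaleˡ c f g (suc n) = trans (cong (c ⊗ f 0 ⊗ g (suc n) ⊕_) (⋆-scaleˡ c (f ∘ suc) g n))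
    (solve 4 (λ c a b x → c :* a :* b :+ c :* x := c :* (a :* b :+ x)) refl c (f 0) (g (suc n)) (((f ∘ suc) ⋆ g) n))

  ⋆-scaleʳ : ∀ c f g n → (f ⋆ (λ k → c ⊗ g k)) n ≡ c ⊗ (f ⋆ g) n
  ⋆-scaleʳ c f g zero    = solve 3 (λ c a b → a :* (c :* b) := c :* (a :* b)) refl c (f 0) (g 0)
  ⋆-scaleʳ c f g (suc n) = trans (cong (f 0 ⊗ (c ⊗ g (suc n)) ⊕_) (⋆-scaleʳ c (f ∘ suc) g n))
    (solve 4 (λ c a b x → a :* (c :* b) :+ c :* x := c :* (a :* b :+ x)) refl c (f 0) (g (suc n)) (((f ∘ suc) ⋆ g) n))

  -- Splits off the summand with `g 0`, where the defining recursion splits off the one with `f 0`;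
  -- this gives access to index shifts in the second factor.
  ⋆-suc : ∀ f g n → (f ⋆ g) (suc n) ≡ (f ⋆ (g ∘ suc)) n ⊕ f (suc n) ⊗ g 0
  ⋆-suc f g zero    = refl
  ⋆-suc f g (suc n) = trans (cong (f 0 ⊗ g (suc (suc n)) ⊕_) (⋆-suc (f ∘ suc) g n))
    (sym (⊕-assoc (f 0 ⊗ g (suc (suc n))) (((f ∘ suc) ⋆ (g ∘ suc)) n) (f (suc (suc n)) ⊗ g 0)))

  ⋆-suc-zero : ∀ f g n → g 0 ≡ 𝟘 → (f ⋆ g) (suc n) ≡ (f ⋆ (g ∘ suc)) n
  ⋆-suc-zero f g n g0≡0 = begin
    (f ⋆ g) (suc n)                          ≡⟨ ⋆-suc f g n ⟩
    (f ⋆ (g ∘ suc)) n ⊕ f (suc n) ⊗ g 0      ≡⟨ cong (λ t → (f ⋆ (g ∘ suc)) n ⊕ f (suc n) ⊗ t) g0≡0 ⟩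
    (f ⋆ (g ∘ suc)) n ⊕ f (suc n) ⊗ 𝟘        ≡⟨ solve 2 (λ x y → x :+ y :* con 𝟘 := x) refl ((f ⋆ (g ∘ suc)) n) (f (suc n)) ⟩
    (f ⋆ (g ∘ suc)) n                        ∎

  ⋆-const : ∀ f c n → (f ⋆ const c) n ≡ Σ< f (suc n) ⊗ c
  ⋆-const f c zero    = cong (_⊗ c) (sym (⊕-identityˡ (f 0)))
  ⋆-const f c (suc n) = begin
    (f ⋆ const c) (suc n)                    ≡⟨ ⋆-suc f (const c) n ⟩
    (f ⋆ const c) n ⊕ f (suc n) ⊗ c          ≡⟨ cong (_⊕ f (suc n) ⊗ c) (⋆-const f c n) ⟩
    Σ< f (suc n) ⊗ c ⊕ f (suc n) ⊗ c         ≡⟨ ⊗-distribʳ-⊕ c (Σ< f (suc n)) (f (suc n)) ⟨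
    Σ< f (suc (suc n)) ⊗ c                   ∎

  -- In generating functions `Σ<` is multiplication by x/(1 - x), which may be moved onto either
  -- factor.
  Σ<-⋆ : ∀ f g n → Σ< (f ⋆ g) n ≡ (f ⋆ Σ< g) n
  Σ<-⋆ f g zero    = solve 1 (λ x → con 𝟘 := x :* con 𝟘) refl (f 0)
  Σ<-⋆ f g (suc n) = begin
    Σ< (f ⋆ g) n ⊕ (f ⋆ g) n                 ≡⟨ cong (_⊕ (f ⋆ g) n) (Σ<-⋆ f g n) ⟩
    (f ⋆ Σ< g) n ⊕ (f ⋆ g) n                 ≡⟨ ⋆-distribˡ f (Σ< g) g n ⟨
    (f ⋆ (Σ< g ∘ suc)) n                     ≡⟨ ⋆-suc-zero f (Σ< g) n refl ⟨
    (f ⋆ Σ< g) (suc n)                       ∎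

  cast-suc : ∀ n → cast (suc n) ≡ 𝟙 ⊕ cast n
  cast-suc n = cong (_⊹ 0ℚ) (fromℕ-+ 1 n)

  θ-∘suc : ∀ f k → θ f (suc k) ≡ θ (f ∘ suc) k ⊕ f (suc k)
  θ-∘suc f k = trans (cong (_⊗ f (suc k)) (cast-suc k))
    (solve 2 (λ n x → (con 𝟙 :+ n) :* x := n :* x :+ x) refl (cast k) (f (suc k)))

  -- The weight n of a summand is i + (n - i). The induction takes one unit off n at a time, and
  -- `θ-∘suc` restores that unit when the first factor is shifted.
  θ-⋆ : ∀ f g n → θ (f ⋆ g) n ≡ (θ f ⋆ g) n ⊕ (f ⋆ θ g) n
  θ-⋆ f g zero    = solve 2 (λ x y → con 𝟘 :* (x :* y) := (con 𝟘 :* x) :* y :+ x :* (con 𝟘 :* y)) refl (f 0) (g 0)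
  θ-⋆ f g (suc n) = begin
    cast (suc n) ⊗ (f 0 ⊗ g (suc n) ⊕ s)
      ≡⟨ ⊗-distribˡ-⊕ (cast (suc n)) (f 0 ⊗ g (suc n)) s ⟩
    cast (suc n) ⊗ (f 0 ⊗ g (suc n)) ⊕ cast (suc n) ⊗ s
      ≡⟨ cong (λ t → cast (suc n) ⊗ (f 0 ⊗ g (suc n)) ⊕ t ⊗ s) (cast-suc n) ⟩
    cast (suc n) ⊗ (f 0 ⊗ g (suc n)) ⊕ (𝟙 ⊕ cast n) ⊗ s
      ≡⟨ solve 5 (λ m n a b s → m :* (a :* b) :+ (con 𝟙 :+ n) :* s := a :* (m :* b) :+ (n :* s :+ s)) refl
           (cast (suc n)) (cast n) (f 0) (g (suc n)) s ⟩
    f 0 ⊗ θ g (suc n) ⊕ (θ ((f ∘ suc) ⋆ g) n ⊕ s)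
      ≡⟨ cong (λ t → f 0 ⊗ θ g (suc n) ⊕ (t ⊕ s)) (θ-⋆ (f ∘ suc) g n) ⟩
    f 0 ⊗ θ g (suc n) ⊕ ((p ⊕ q) ⊕ s)
      -- `θ f 0` is `𝟘 ⊗ f 0`, so the first summand of `θ f ⋆ g` can be inserted freely.
      ≡⟨ solve 6 (λ a b c p q s → a :* b :+ ((p :+ q) :+ s) := (con 𝟘 :* a :* c :+ (p :+ s)) :+ (a :* b :+ q)) refl
           (f 0) (θ g (suc n)) (g (suc n)) p q s ⟩
    (θ f 0 ⊗ g (suc n) ⊕ (p ⊕ s)) ⊕ (f ⋆ θ g) (suc n)
      ≡⟨ cong (λ t → (θ f 0 ⊗ g (suc n) ⊕ t) ⊕ (f ⋆ θ g) (suc n))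
           (trans (sym (⋆-distribʳ (θ (f ∘ suc)) (f ∘ suc) g n)) (⋆-cong (λ k → sym (θ-∘suc f k)) (λ _ → refl) n)) ⟩
    (θ f ⋆ g) (suc n) ⊕ (f ⋆ θ g) (suc n) ∎
    where
    s p q : ℚ[i]
    s = ((f ∘ suc) ⋆ g) n
    p = (θ (f ∘ suc) ⋆ g) n
    q = ((f ∘ suc) ⋆ θ g) n

  cast-inverse : ∀ n → cast (suc n) ⊗ (1/ fromℕ (suc n) ⊹ 0ℚ) ≡ 𝟙
  cast-inverse n = trans
    (cong₂ _⊹_ (R.solve 2 (λ a b → a R.:* b R.:- R.con 0ℚ R.:* R.con 0ℚ R.:= a R.:* b) refl a u)
               (R.solve 2 (λ a b → a R.:* R.con 0ℚ R.:+ R.con 0ℚ R.:* b R.:= R.con 0ℚ) refl a u))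
    (cong (_⊹ 0ℚ) (*-inverseʳ a))
    where
    module R = +-*-Solver
    a u : ℚ
    a = fromℕ (suc n)
    u = 1/ fromℕ (suc n)

  cast-cancel : ∀ n {x y} → cast (suc n) ⊗ x ≡ cast (suc n) ⊗ y → x ≡ y
  cast-cancel n {x} {y} h = trans (sym (undo x)) (trans (cong (u ⊗_) h) (undo y))
    where
    u : ℚ[i]
    u = 1/ fromℕ (suc n) ⊹ 0ℚ
    undo : ∀ t → u ⊗ (cast (suc n) ⊗ t) ≡ t
    undo t = begin
      u ⊗ (cast (suc n) ⊗ t)   ≡⟨ solve 3 (λ u m t → u :* (m :* t) := (m :* u) :* t) refl u (cast (suc n)) t ⟩
      (cast (suc n) ⊗ u) ⊗ t   ≡⟨ cong (_⊗ t) (cast-inverse n) ⟩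
      𝟙 ⊗ t                    ≡⟨ ⊗-identityˡ t ⟩
      t                        ∎

  invFactorial-suc : ∀ n → (invFactorial (suc n) ⊹ 0ℚ) ≡ (invFactorial n ⊹ 0ℚ) ⊗ (1/ fromℕ (suc n) ⊹ 0ℚ)
  invFactorial-suc n = cong₂ _⊹_
    (solve′ 2 (λ a b → a R.:* b R.:= a R.:* b R.:- R.con 0ℚ R.:* R.con 0ℚ) refl (invFactorial n) (1/ fromℕ (suc n)))
    (solve′ 2 (λ a b → R.con 0ℚ R.:= a R.:* R.con 0ℚ R.:+ R.con 0ℚ R.:* b) refl (invFactorial n) (1/ fromℕ (suc n)))
    where
    module R = +-*-Solver
    open R using () renaming (solve to solve′)

  θ-expTerm : ∀ z n → θ (expTerm z) (suc n) ≡ z ⊗ expTerm z n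
  θ-expTerm z n = begin
    m ⊗ ((invFactorial (suc n) ⊹ 0ℚ) ⊗ (z ⊗ pow z n))   ≡⟨ cong (λ t → m ⊗ (t ⊗ (z ⊗ pow z n))) (invFactorial-suc n) ⟩
    m ⊗ ((i ⊗ u) ⊗ (z ⊗ pow z n))                       ≡⟨ solve 5 (λ m i u z p → m :* ((i :* u) :* (z :* p))
                                                            := (m :* u) :* (z :* (i :* p))) refl m i u z (pow z n) ⟩
    (m ⊗ u) ⊗ (z ⊗ expTerm z n)                         ≡⟨ cong (_⊗ (z ⊗ expTerm z n)) (cast-inverse n) ⟩
    𝟙 ⊗ (z ⊗ expTerm z n)                               ≡⟨ ⊗-identityˡ (z ⊗ expTerm z n) ⟩
    z ⊗ expTerm z n                                     ∎
    where
    m i u : ℚ[i]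
    m = cast (suc n)
    i = invFactorial n ⊹ 0ℚ
    u = 1/ fromℕ (suc n) ⊹ 0ℚ

  -- Both sides satisfy θ c (n + 1) = (z + w) c n and c 0 = 1.
  expTerm-⋆ : ∀ z w n → (expTerm z ⋆ expTerm w) n ≡ expTerm (z ⊕ w) n
  expTerm-⋆ z w zero    = refl
  expTerm-⋆ z w (suc n) = cast-cancel n (begin
    θ (e ⋆ f) (suc n)
      ≡⟨ θ-⋆ e f (suc n) ⟩
    (𝟘 ⊗ f (suc n) ⊕ ((θ e ∘ suc) ⋆ f) n) ⊕ (e ⋆ θ f) (suc n)
      ≡⟨ cong₂ (λ s t → (𝟘 ⊗ f (suc n) ⊕ s) ⊕ t)
           (trans (⋆-cong (θ-expTerm z) (λ _ → refl) n) (⋆-scaleˡ z e f n))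
           (trans (⋆-suc-zero e (θ f) n refl) (trans (⋆-cong (λ _ → refl) (θ-expTerm w) n) (⋆-scaleʳ w e f n))) ⟩
    (𝟘 ⊗ f (suc n) ⊕ z ⊗ (e ⋆ f) n) ⊕ w ⊗ (e ⋆ f) n
      ≡⟨ solve 4 (λ z w x c → (con 𝟘 :* x :+ z :* c) :+ w :* c := (z :+ w) :* c) refl z w (f (suc n)) ((e ⋆ f) n) ⟩
    (z ⊕ w) ⊗ (e ⋆ f) n
      ≡⟨ cong ((z ⊕ w) ⊗_) (expTerm-⋆ z w n) ⟩
    (z ⊕ w) ⊗ expTerm (z ⊕ w) n
      ≡⟨ θ-expTerm (z ⊕ w) n ⟨
    θ (expTerm (z ⊕ w)) (suc n) ∎)
    where
    e f : ℕ → ℚ[i]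
    e = expTerm z
    f = expTerm w

  -- `expℚ (suc k) w` holds the terms j ≤ k, so the left side runs over the triangle i + j ≤ n,
  -- whose diagonals are the terms of the series at z + w.
  expℚ-⋆ : ∀ z w n → (expTerm z ⋆ (λ k → expℚ (suc k) w)) n ≡ expℚ (suc n) (z ⊕ w)
  expℚ-⋆ z w n = begin
    (expTerm z ⋆ (λ k → expℚ (suc k) w)) n          ≡⟨ ⋆-cong {expTerm z} (λ _ → refl) (λ k → expℚ≡Σ< w (suc k)) n ⟩
    (expTerm z ⋆ (Σ< (expTerm w) ∘ suc)) n          ≡⟨ ⋆-suc-zero (expTerm z) (Σ< (expTerm w)) n refl ⟨
    (expTerm z ⋆ Σ< (expTerm w)) (suc n)            ≡⟨ Σ<-⋆ (expTerm z) (expTerm w) (suc n) ⟨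
    Σ< (expTerm z ⋆ expTerm w) (suc n)              ≡⟨ Σ<-cong (expTerm-⋆ z w) (suc n) ⟩
    Σ< (expTerm (z ⊕ w)) (suc n)                    ≡⟨ expℚ≡Σ< (z ⊕ w) (suc n) ⟨
    expℚ (suc n) (z ⊕ w)                            ∎
    where
    Σ<-cong : ∀ {f g} → (∀ k → f k ≡ g k) → ∀ n → Σ< f n ≡ Σ< g n
    Σ<-cong h zero    = refl
    Σ<-cong h (suc n) = cong₂ _⊕_ (Σ<-cong h n) (h n)

  -- The product of the partial sums covers the square i, j ≤ n. Taking away the triangle i + j ≤ n
  -- leaves, for each i, the terms of the series of w with n - i < j ≤ n.
  expℚ-defect : ∀ z w n → (expTerm z ⋆ (λ k → expℚ (suc n) w ⊖ expℚ (suc k) w)) n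
                        ≡ expℚ (suc n) z ⊗ expℚ (suc n) w ⊖ expℚ (suc n) (z ⊕ w)
  expℚ-defect z w n = begin
    (expTerm z ⋆ (λ k → c ⊖ expℚ (suc k) w)) n
      ≡⟨ ⋆-cong {expTerm z} (λ _ → refl) (λ k → ⊖-as-⊕ c (expℚ (suc k) w)) n ⟩
    (expTerm z ⋆ (λ k → c ⊕ ⊝ 𝟙 ⊗ expℚ (suc k) w)) n
      ≡⟨ ⋆-distribˡ (expTerm z) (const c) (λ k → ⊝ 𝟙 ⊗ expℚ (suc k) w) n ⟩
    (expTerm z ⋆ const c) n ⊕ (expTerm z ⋆ (λ k → ⊝ 𝟙 ⊗ expℚ (suc k) w)) n
      ≡⟨ cong₂ _⊕_ (trans (⋆-const (expTerm z) c n) (cong (_⊗ c) (sym (expℚ≡Σ< z (suc n)))))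
                   (trans (⋆-scaleʳ (⊝ 𝟙) (expTerm z) (λ k → expℚ (suc k) w) n) (cong (⊝ 𝟙 ⊗_) (expℚ-⋆ z w n))) ⟩
    expℚ (suc n) z ⊗ c ⊕ ⊝ 𝟙 ⊗ expℚ (suc n) (z ⊕ w)
      ≡⟨ ⊖-as-⊕ (expℚ (suc n) z ⊗ c) (expℚ (suc n) (z ⊕ w)) ⟨
    expℚ (suc n) z ⊗ c ⊖ expℚ (suc n) (z ⊕ w) ∎
    where
    c : ℚ[i]
    c = expℚ (suc n) w
    ⊖-as-⊕ : ∀ x y → x ⊖ y ≡ x ⊕ ⊝ 𝟙 ⊗ y
    ⊖-as-⊕ x y = solve 2 (λ x y → x :+ :- y := x :+ :- con 𝟙 :* y) refl x y

-- Estimates for Cauchy products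

module ConvolutionBounds where
  open ℚR
  open +-*-Solver

  -- Bounding norms by increments of σ makes sums of norms telescope, and the shift `f ∘ suc` in the
  -- recursion of `⋆` is matched by `σ ∘ suc`.
  Dominates : (ℕ → ℚ) → (ℕ → ℚ[i]) → Set
  Dominates σ f = ∀ k → ‖ f k ‖ ≤ σ (suc k) - σ k

  ⋆-bounded : ∀ {C} → 0ℚ ≤ C → ∀ σ f h → Dominates σ f → ∀ n → (∀ k → k ℕ.≤ n → ‖ h k ‖ ≤ C) →
              ‖ (f ⋆ h) n ‖ ≤ C * (σ (suc n) - σ 0)
  ⋆-bounded {C} 0≤C σ f h dom zero h≤C = begin
    ‖ f 0 ⊗ h 0 ‖               ≤⟨ ‖⊗‖ (f 0) (h 0) ⟩
    ‖ f 0 ‖ * ‖ h 0 ‖           ≤⟨ mono* (≤-trans (0≤‖‖ (f 0)) (dom 0)) (0≤‖‖ (h 0)) (dom 0) (h≤C 0 ℕ.z≤n) ⟩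
    (σ 1 - σ 0) * C             ≡⟨ *-comm (σ 1 - σ 0) C ⟩
    C * (σ 1 - σ 0)             ∎
  ⋆-bounded {C} 0≤C σ f h dom (suc n) h≤C = begin
    ‖ f 0 ⊗ h (suc n) ⊕ ((f ∘ suc) ⋆ h) n ‖          ≤⟨ ‖⊕‖ (f 0 ⊗ h (suc n)) (((f ∘ suc) ⋆ h) n) ⟩
    ‖ f 0 ⊗ h (suc n) ‖ + ‖ ((f ∘ suc) ⋆ h) n ‖      ≤⟨ +-mono-≤ (≤-trans (‖⊗‖ (f 0) (h (suc n)))
                                                        (mono* (≤-trans (0≤‖‖ (f 0)) (dom 0)) (0≤‖‖ (h (suc n))) (dom 0) (h≤C (suc n) ℕₚ.≤-refl)))
                                                        (⋆-bounded 0≤C (σ ∘ suc) (f ∘ suc) h (dom ∘ suc) n (λ k p → h≤C k (ℕₚ.m≤n⇒m≤1+n p))) ⟩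
    (σ 1 - σ 0) * C + C * (σ (suc (suc n)) - σ 1)    ≡⟨ solve 4 (λ c a b d → (b :- a) :* c :+ c :* (d :- b) := c :* (d :- a)) refl
                                                          C (σ 0) (σ 1) (σ (suc (suc n))) ⟩
    C * (σ (suc (suc n)) - σ 0)                      ∎

  -- Splits the sum over i at k. For i < k the index k + M - i of h exceeds M, so ε applies; for i ≥
  -- k only the bound C is left, but the increments of σ from k on are meant to be small.
  ⋆-null : ∀ {C ε M} → 0ℚ ≤ C → ∀ σ f h → Dominates σ f → ∀ k → (∀ j → j ℕ.≤ k ℕ.+ M → ‖ h j ‖ ≤ C) →
           (∀ j → M ℕ.≤ j → j ℕ.≤ k ℕ.+ M → ‖ h j ‖ ≤ ε) →
           ‖ (f ⋆ h) (k ℕ.+ M) ‖ ≤ ε * (σ k - σ 0) + C * (σ (suc (k ℕ.+ M)) - σ k)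
  ⋆-null {C} {ε} {M} 0≤C σ f h dom zero h≤C h≤ε = begin
    ‖ (f ⋆ h) M ‖                                    ≤⟨ ⋆-bounded 0≤C σ f h dom M h≤C ⟩
    C * (σ (suc M) - σ 0)                            ≡⟨ solve 4 (λ e c a b → c :* (b :- a) := e :* (a :- a) :+ c :* (b :- a)) refl
                                                          ε C (σ 0) (σ (suc M)) ⟩
    ε * (σ 0 - σ 0) + C * (σ (suc M) - σ 0)          ∎
  ⋆-null {C} {ε} {M} 0≤C σ f h dom (suc k) h≤C h≤ε = begin
    ‖ f 0 ⊗ h (suc m) ⊕ ((f ∘ suc) ⋆ h) m ‖          ≤⟨ ‖⊕‖ (f 0 ⊗ h (suc m)) (((f ∘ suc) ⋆ h) m) ⟩
    ‖ f 0 ⊗ h (suc m) ‖ + ‖ ((f ∘ suc) ⋆ h) m ‖      ≤⟨ +-mono-≤ (≤-trans (‖⊗‖ (f 0) (h (suc m)))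
                                                        (mono* (≤-trans (0≤‖‖ (f 0)) (dom 0)) (0≤‖‖ (h (suc m))) (dom 0)
                                                          (h≤ε (suc m) (ℕₚ.m≤n+m M (suc k)) ℕₚ.≤-refl)))
                                                        (⋆-null 0≤C (σ ∘ suc) (f ∘ suc) h (dom ∘ suc) k
                                                          (λ j p → h≤C j (ℕₚ.m≤n⇒m≤1+n p)) (λ j p q → h≤ε j p (ℕₚ.m≤n⇒m≤1+n q))) ⟩
    (σ 1 - σ 0) * ε + (ε * (σ (suc k) - σ 1) + C * (σ (suc (suc m)) - σ (suc k)))
      ≡⟨ solve 5 (λ e a b d r → (b :- a) :* e :+ (e :* (d :- b) :+ r) := e :* (d :- a) :+ r) refl
           ε (σ 0) (σ 1) (σ (suc k)) (C * (σ (suc (suc m)) - σ (suc k))) ⟩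
    ε * (σ (suc k) - σ 0) + C * (σ (suc (suc m)) - σ (suc k)) ∎
    where
    m : ℕ
    m = k ℕ.+ M

  module _ (β : ℕ) where
    open Majorant β

    ‖expℚ-⊖‖≤S : ∀ z → ‖ z ‖ ≤ B → ∀ {m n} → m ℕ.≤ n → ‖ expℚ n z ⊖ expℚ m z ‖ ≤ S
    ‖expℚ-⊖‖≤S z z≤B {m} {n} m≤n = begin
      ‖ expℚ n z ⊖ expℚ m z ‖          ≤⟨ p≤q+p (‖ expℚ n z ⊖ expℚ m z ‖) (s-mono {0} {m} (ℕₚ.≤⇒≤′ ℕ.z≤n)) ⟩
      s m + ‖ expℚ n z ⊖ expℚ m z ‖    ≤⟨ expℚ-tail z z≤B (ℕₚ.≤⇒≤′ m≤n) ⟩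
      s n                              ≤⟨ s-bounded n ⟩
      S                                ∎

    s-dominates : ∀ z → ‖ z ‖ ≤ B → Dominates s (expTerm z)
    s-dominates z z≤B k = ≤-trans (‖term‖ z z≤B k)
      (≤-reflexive (solve 2 (λ s b → b := (s :+ b) :- s) refl (s k) (b k)))

    expℚ-⊕-close : ∀ ε → 0ℚ < ε → ∃[ N ] (∀ n → N ℕ.≤ n → ∀ z w → ‖ z ‖ ≤ B → ‖ w ‖ ≤ B →
                   ‖ expℚ n z ⊗ expℚ n w ⊖ expℚ n (z ⊕ w) ‖ ≤ ε)
    expℚ-⊕-close ε 0<ε =
      let δ , 0<δ , Sδ≤ = shrink S (½ * ε) 0≤S (0<½* 0<ε)
          M , f = expℚ-cauchy δ 0<δ
          K , g = s-tail δ 0<δ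
      -- M controls the partial sums, K the tail of the majorant. For n ≥ K + M the cut k = n - M is
      -- at least K, so both controls apply. The successor matches `expℚ-defect`.
      in suc (K ℕ.+ M) , λ { (suc n) (ℕ.s≤s K+M≤n) z w z≤B w≤B → bound δ 0<δ Sδ≤ M f K g n K+M≤n z w z≤B w≤B }
      where
      bound : ∀ δ → 0ℚ < δ → S * δ ≤ ½ * ε →
              ∀ M → (∀ z → ‖ z ‖ ≤ B → ∀ m n → M ℕ.≤ m → M ℕ.≤ n → ‖ expℚ m z ⊖ expℚ n z ‖ ≤ δ) →
              ∀ K → (∀ {m n} → K ℕ.≤ m → m ℕ.≤ n → s n ≤ s m + δ) →
              ∀ n → K ℕ.+ M ℕ.≤ n → ∀ z w → ‖ z ‖ ≤ B → ‖ w ‖ ≤ B →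
              ‖ expℚ (suc n) z ⊗ expℚ (suc n) w ⊖ expℚ (suc n) (z ⊕ w) ‖ ≤ ε
      bound δ 0<δ Sδ≤ M f K g n K+M≤n z w z≤B w≤B = begin
        ‖ expℚ (suc n) z ⊗ expℚ (suc n) w ⊖ expℚ (suc n) (z ⊕ w) ‖
          ≡⟨ cong ‖_‖ (Convolution.expℚ-defect z w n) ⟨
        ‖ (expTerm z ⋆ h) n ‖
          ≡⟨ cong (λ t → ‖ (expTerm z ⋆ h) t ‖) k+M≡n ⟨
        ‖ (expTerm z ⋆ h) (k ℕ.+ M) ‖
          ≤⟨ ⋆-null 0≤S s (expTerm z) h (s-dominates z z≤B) k
               (λ j p → ‖expℚ-⊖‖≤S w w≤B (ℕ.s≤s (ℕₚ.≤-trans p (ℕₚ.≤-reflexive k+M≡n))))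
               (λ j p _ → f w w≤B (suc n) (suc j) (ℕₚ.m≤n⇒m≤1+n (ℕₚ.m+n≤o⇒n≤o K K+M≤n)) (ℕₚ.m≤n⇒m≤1+n p)) ⟩
        δ * (s k - s 0) + S * (s (suc (k ℕ.+ M)) - s k)
          ≤⟨ +-mono-≤ (monoˡ (<⇒≤ 0<δ) (≤-trans (≤-reflexive (+-identityʳ (s k))) (s-bounded k)))
                      (monoˡ 0≤S (diff≤ (g K≤k (ℕₚ.m≤n⇒m≤1+n (ℕₚ.m≤m+n k M))))) ⟩
        δ * S + S * δ
          ≡⟨ cong (_+ S * δ) (*-comm δ S) ⟩
        S * δ + S * δ
          ≤⟨ +-mono-≤ Sδ≤ Sδ≤ ⟩
        ½ * ε + ½ * ε
          ≡⟨ halves ε ⟩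
        ε ∎
        where
        h : ℕ → ℚ[i]
        h k = expℚ (suc n) w ⊖ expℚ (suc k) w
        k : ℕ
        k = n ℕ.∸ M
        k+M≡n : k ℕ.+ M ≡ n
        k+M≡n = ℕₚ.m∸n+n≡m (ℕₚ.m+n≤o⇒n≤o K K+M≤n)
        K≤k : K ℕ.≤ k
        K≤k = ℕₚ.m+n≤o⇒m≤o∸n K K+M≤n
        diff≤ : ∀ {p q e} → p ≤ q + e → p - q ≤ e
        diff≤ {p} {q} {e} h = subst (p - q ≤_) (solve 2 (λ q e → q :+ e :- q := e) refl q e) (+-monoˡ-≤ (- q) h)

open ConvolutionBounds using (expℚ-⊕-close)

-- The exponential law on ℂ

approx-bounded₂ : ∀ z w → ∃[ β ] ∃[ N ] (∀ n → N ℕ.≤ n → ‖ approx z n ‖ ≤ fromℕ β × ‖ approx w n ‖ ≤ fromℕ β)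
approx-bounded₂ z w =
  let α , M , a = approx-bounded z
      β , N , b = approx-bounded w
  in α ℕ.⊔ β , M ℕ.⊔ N , λ n p →
    ≤-trans (a n (⊔ˡ {M} p)) (fromℕ-mono (ℕₚ.m≤m⊔n α β)) , ≤-trans (b n (⊔ʳ {M} p)) (fromℕ-mono (ℕₚ.m≤n⊔m α β))

exp-cong : ∀ {z w} → z ≋ w → exp z ≋ exp w
exp-cong {z} {w} h = close λ ε 0<ε →
  let β , L , bd = approx-bounded₂ z w
      M , δ , 0<δ , cl = Majorant.expℚ-close β ε 0<ε
      N , d = dist h δ 0<δ
  in L ℕ.⊔ (M ℕ.⊔ N) , λ n p →
    let z≤B , w≤B = bd n (⊔ˡ {L} p)
        M≤n = ⊔ˡ {M} (⊔ʳ {L} p)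
    in cl n n M≤n M≤n (approx z n) (approx w n) z≤B w≤B (d n (⊔ʳ {M} (⊔ʳ {L} p)))

-- The n-th approximant of z + w is the sum of those of z and w, so the uniform estimate applies
-- directly at index n.
exp-+ : ∀ z w → exp (z +ᶜ w) ≋ exp z *ᶜ exp w
exp-+ z w = ≋-sym (close λ ε 0<ε →
  let β , L , bd = approx-bounded₂ z w
      N , cl = expℚ-⊕-close β ε 0<ε
  in L ℕ.⊔ N , λ n p → let z≤B , w≤B = bd n (⊔ˡ {L} p) in
    cl n (⊔ʳ {L} p) (approx z n) (approx w n) z≤B w≤B)

exp-0 : exp 0ᶜ ≋ 1ᶜ
-- The partial sum with no terms is `𝟘`, so agreement starts at index 1.
exp-0 = eventually-≡⇒≋ 1 λ { (suc n) _ → expℚ-𝟘 n }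
  where
  open ℚ[i]-Solver
  expℚ-𝟘 : ∀ n → expℚ (suc n) 𝟘 ≡ 𝟙
  expℚ-𝟘 zero    = refl
  expℚ-𝟘 (suc n) = trans (cong (_⊕ expTerm 𝟘 (suc n)) (expℚ-𝟘 n))
    (solve 2 (λ i p → con 𝟙 :+ i :* (con 𝟘 :* p) := con 𝟙) refl (invFactorial (suc n) ⊹ 0ℚ) (pow 𝟘 n))

-- Inverses and apartness from zero

module _ where
  open +-*-Solver
  open ℚR

  -- At `approx z n` this computes to the n-th approximant of `∣ z ∣²`.
  sq : ℚ[i] → ℚ
  sq (a ⊹ b) = a * a + b * b

  sq-⊗ : ∀ x y → sq (x ⊗ y) ≡ sq x * sq y
  sq-⊗ (a ⊹ b) (c ⊹ d) = solve 4 (λ a b c d →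
    (a :* c :- b :* d) :* (a :* c :- b :* d) :+ (a :* d :+ b :* c) :* (a :* d :+ b :* c)
      := (a :* a :+ b :* b) :* (c :* c :+ d :* d)) refl a b c d

  p*p≡∣p∣*∣p∣ : ∀ p → p * p ≡ ∣ p ∣ * ∣ p ∣
  p*p≡∣p∣*∣p∣ p with ∣p∣≡p∨∣p∣≡-p p
  ... | inj₁ eq = cong₂ _*_ (sym eq) (sym eq)
  ... | inj₂ eq = trans (solve 1 (λ p → p :* p := (:- p) :* (:- p)) refl p) (cong₂ _*_ (sym eq) (sym eq))

  sq≤‖‖² : ∀ x → sq x ≤ ‖ x ‖ * ‖ x ‖
  sq≤‖‖² (a ⊹ b) = begin
    a * a + b * b                                  ≡⟨ cong₂ _+_ (p*p≡∣p∣*∣p∣ a) (p*p≡∣p∣*∣p∣ b) ⟩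
    ∣ a ∣ * ∣ a ∣ + ∣ b ∣ * ∣ b ∣                  ≤⟨ p≤p+q (∣ a ∣ * ∣ a ∣ + ∣ b ∣ * ∣ b ∣) (0≤+ 0≤ab 0≤ab) ⟩
    ∣ a ∣ * ∣ a ∣ + ∣ b ∣ * ∣ b ∣ + (∣ a ∣ * ∣ b ∣ + ∣ a ∣ * ∣ b ∣)
      ≡⟨ solve 2 (λ a b → a :* a :+ b :* b :+ (a :* b :+ a :* b) := (a :+ b) :* (a :+ b)) refl (∣ a ∣) (∣ b ∣) ⟩
    (∣ a ∣ + ∣ b ∣) * (∣ a ∣ + ∣ b ∣)              ∎
    where
    0≤ab : 0ℚ ≤ ∣ a ∣ * ∣ b ∣
    0≤ab = 0≤* (0≤∣p∣ a) (0≤∣p∣ b)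

  ¼≤sq : ∀ x → ‖ x ⊖ 𝟙 ‖ ≤ ½ → ½ * ½ ≤ sq x
  ¼≤sq x@(a ⊹ b) h = begin
    ½ * ½               ≤⟨ mono* (0≤∣p∣ a) (nonNegative⁻¹ ½) ½≤∣a∣ ½≤∣a∣ ⟩
    ∣ a ∣ * ∣ a ∣       ≡⟨ p*p≡∣p∣*∣p∣ a ⟨
    a * a               ≤⟨ p≤p+q (a * a) (subst (0ℚ ≤_) (sym (p*p≡∣p∣*∣p∣ b)) (0≤* (0≤∣p∣ b) (0≤∣p∣ b))) ⟩
    a * a + b * b       ∎
    where
    1≤∣a∣+½ : 1ℚ ≤ ∣ a ∣ + ½
    1≤∣a∣+½ = begin
      1ℚ                     ≤⟨ ∣p∣≤∣q∣+dist 1ℚ a ⟩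
      ∣ a ∣ + ∣ 1ℚ - a ∣     ≡⟨ cong (∣ a ∣ +_) (dist-sym 1ℚ a) ⟩
      ∣ a ∣ + ∣ a - 1ℚ ∣     ≤⟨ +-monoʳ-≤ ∣ a ∣ (≤-trans (∣re∣≤ (x ⊖ 𝟙)) h) ⟩
      ∣ a ∣ + ½              ∎
    ½≤∣a∣ : ½ ≤ ∣ a ∣
    ½≤∣a∣ = subst (½ ≤_) (solve 1 (λ t → t :+ con ½ :- con ½ := t) refl (∣ a ∣)) (+-monoˡ-≤ (- ½) 1≤∣a∣+½)

  -- Apartness asks for an explicit lower bound on |z|². Eventually zw is within ½ of 1, so |z|²|w|²
  -- ≥ ¼, while |w|² stays below a constant C; any δ with Cδ ≤ ¼ then works.
  invertible⇒#0 : ∀ z w → z *ᶜ w ≋ 1ᶜ → z #0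
  invertible⇒#0 z w (close h) =
    let β , M , bd = approx-bounded w
        N , d = h ½ (positive⁻¹ ½)
        -- The successor keeps C positive even for β = 0, so that C can be cancelled.
        C = fromℕ (suc β ℕ.* suc β)
        δ , 0<δ , Cδ≤¼ = shrink C (½ * ½) (0≤fromℕ (suc β ℕ.* suc β)) (positive⁻¹ (½ * ½))
    in δ , 0<δ , M ℕ.⊔ N , λ n p → *-cancelˡ-≤-pos C (begin
      C * (0ℚ + δ)                               ≡⟨ cong (C *_) (+-identityˡ δ) ⟩
      C * δ                                      ≤⟨ Cδ≤¼ ⟩
      ½ * ½                                      ≤⟨ ¼≤sq (approx z n ⊗ approx w n) (d n (⊔ʳ {M} p)) ⟩
      sq (approx z n ⊗ approx w n)               ≡⟨ sq-⊗ (approx z n) (approx w n) ⟩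
      sq (approx z n) * sq (approx w n)          ≤⟨ monoˡ (0≤sq (approx z n)) (sq≤C β (approx w n) (bd n (⊔ˡ {M} p))) ⟩
      sq (approx z n) * C                        ≡⟨ *-comm (sq (approx z n)) C ⟩
      C * sq (approx z n)                        ∎)
    where
    0≤sq : ∀ x → 0ℚ ≤ sq x
    0≤sq (a ⊹ b) = subst (0ℚ ≤_) (sym (cong₂ _+_ (p*p≡∣p∣*∣p∣ a) (p*p≡∣p∣*∣p∣ b)))
      (0≤+ (0≤* (0≤∣p∣ a) (0≤∣p∣ a)) (0≤* (0≤∣p∣ b) (0≤∣p∣ b)))
    sq≤C : ∀ β x → ‖ x ‖ ≤ fromℕ β → sq x ≤ fromℕ (suc β ℕ.* suc β)
    sq≤C β x h = ≤-trans (sq≤‖‖² x) (subst (‖ x ‖ * ‖ x ‖ ≤_) (sym (fromℕ-* (suc β) (suc β)))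
      (mono* (0≤fromℕ (suc β)) (0≤‖‖ x) h′ h′))
      where
      h′ : ‖ x ‖ ≤ fromℕ (suc β)
      h′ = ≤-trans h (fromℕ-mono (ℕₚ.n≤1+n β))

  -- From the index in the apartness evidence on, the squared modulus is positive, `recipℚ` is a
  -- true reciprocal, and the identity is exact.
  *-/ᶜ-inverse : ∀ w (w#0 : w #0) → w *ᶜ (1ᶜ /ᶜ w [ w#0 ]) ≋ 1ᶜ
  *-/ᶜ-inverse w w#0@(e , 0<e , N , e≤) = eventually-≡⇒≋ N λ n p → cancel (approx w n)
    (<-≤-trans 0<e (subst (_≤ sq (approx w n)) (+-identityˡ e) (e≤ n p)))
    where
    cancel : ∀ x → 0ℚ < sq x →
      x ⊗ (𝟙 ⊗ (reℚ x * recipℚ (sq x) ⊹ - imℚ x * recipℚ (sq x))) ≡ 𝟙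
    cancel x@(a ⊹ b) 0<sq = cong₂ _⊹_
      (trans (solve 3 (λ a b r → a :* (con 1ℚ :* (a :* r) :- con 0ℚ :* (:- b :* r)) :- b :* (con 1ℚ :* (:- b :* r) :+ con 0ℚ :* (a :* r))
               := (a :* a :+ b :* b) :* r) refl a b (recipℚ (sq x))) (*-recipℚ 0<sq))
      (solve 3 (λ a b r → a :* (con 1ℚ :* (:- b :* r) :+ con 0ℚ :* (a :* r)) :+ b :* (con 1ℚ :* (a :* r) :- con 0ℚ :* (:- b :* r))
        := con 0ℚ) refl a b (recipℚ (sq x)))

private
  module ℂR = CommutativeRing ℂ-commutativeRing

*ᶜ-inverse-unique : ∀ {z v w} → z *ᶜ v ≋ 1ᶜ → z *ᶜ w ≋ 1ᶜ → v ≋ w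
*ᶜ-inverse-unique {z} {v} {w} p q = begin
  v                ≈⟨ solve 1 (λ v → v := con 𝟙 :* v) ≋-refl v ⟩
  1ᶜ *ᶜ v          ≈⟨ ℂR.*-congʳ q ⟨
  z *ᶜ w *ᶜ v      ≈⟨ solve 3 (λ z v w → z :* w :* v := z :* v :* w) ≋-refl z v w ⟩
  z *ᶜ v *ᶜ w      ≈⟨ ℂR.*-congʳ p ⟩
  1ᶜ *ᶜ w          ≈⟨ ℂR.*-identityˡ w ⟩
  w                ∎
  where
  open ≈-Reasoning ℂR.setoid
  open ℂ-Solver

-- Real constants and the golden ratio

ofℝ-cong : ∀ {x y} → x ≈ʳ y → ofℝ x ≋ ofℝ y
ofℝ-cong h = ≈⇒≋ (h , proj₁ (≋⇒≈ {0ᶜ} ≋-refl))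

ofℝ-* : ∀ x y → ofℝ (x *ʳ y) ≋ ofℝ x *ᶜ ofℝ y
ofℝ-* x y = pointwise λ n → cong₂ _⊹_
  (solve 2 (λ a b → a :* b := a :* b :- con 0ℚ :* con 0ℚ) refl (seq x n) (seq y n))
  (solve 2 (λ a b → con 0ℚ := a :* con 0ℚ :+ con 0ℚ :* b) refl (seq x n) (seq y n))
  where open +-*-Solver

√5² : ofℝ √5 *ᶜ ofℝ √5 ≋ ofℝ (ofℚ (fromℕ 5))
√5² = ≋-trans (≋-sym (ofℝ-* √5 √5)) (ofℝ-cong √5*√5≈5)

φ-def : ofℝ φ ≋ ofℝ (ofℚ ½) *ᶜ (1ᶜ +ᶜ ofℝ √5)
φ-def = ≋-trans (ofℝ-* (ofℚ ½) (1ʳ +ʳ √5)) (ℂR.*-congˡ (pointwise λ _ → refl))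

module _ where
  open ≈-Reasoning ℂR.setoid
  open ℂ-Solver

  private
    f s : ℂ
    f = ofℝ φ
    s = ofℝ √5
    h : ℂ
    h = ofℝ (ofℚ ½)

    φ²-expand : f *ᶜ f ≋ h *ᶜ h *ᶜ (1ᶜ +ᶜ 2ᶜ *ᶜ s +ᶜ ofℝ (ofℚ (fromℕ 5)))
    φ²-expand = begin
      f *ᶜ f                                       ≈⟨ ℂR.*-cong φ-def φ-def ⟩
      h *ᶜ (1ᶜ +ᶜ s) *ᶜ (h *ᶜ (1ᶜ +ᶜ s))           ≈⟨ solve 2 (λ h s → h :* (con 𝟙 :+ s) :* (h :* (con 𝟙 :+ s))
                                                        := h :* h :* (con 𝟙 :+ con (cast 2) :* s :+ s :* s)) ≋-refl h s ⟩
      h *ᶜ h *ᶜ (1ᶜ +ᶜ 2ᶜ *ᶜ s +ᶜ s *ᶜ s)          ≈⟨ ℂR.*-congˡ (ℂR.+-congˡ √5²) ⟩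
      h *ᶜ h *ᶜ (1ᶜ +ᶜ 2ᶜ *ᶜ s +ᶜ ofℝ (ofℚ (fromℕ 5))) ∎

  φ²≋φ+1 : ofℝ φ *ᶜ ofℝ φ ≋ ofℝ φ +ᶜ 1ᶜ
  φ²≋φ+1 = begin
    f *ᶜ f                                             ≈⟨ φ²-expand ⟩
    h *ᶜ h *ᶜ (1ᶜ +ᶜ 2ᶜ *ᶜ s +ᶜ ofℝ (ofℚ (fromℕ 5)))   ≈⟨ solve 1 (λ s → con (½ ⊹ 0ℚ) :* con (½ ⊹ 0ℚ) :* (con 𝟙 :+ con (cast 2) :* s :+ con (cast 5))
                                                              := con (½ ⊹ 0ℚ) :* (con 𝟙 :+ s) :+ con 𝟙) ≋-refl s ⟩
    h *ᶜ (1ᶜ +ᶜ s) +ᶜ 1ᶜ                               ≈⟨ ℂR.+-congʳ φ-def ⟨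
    f +ᶜ 1ᶜ                                            ∎

  -- The left side comes to ½(√5 + 5); reading 5 as √5² again exposes the factor √5.
  1+φ²≋√5φ : 1ᶜ +ᶜ ofℝ φ *ᶜ ofℝ φ ≋ ofℝ √5 *ᶜ ofℝ φ
  1+φ²≋√5φ = begin
    1ᶜ +ᶜ f *ᶜ f                                       ≈⟨ ℂR.+-congˡ φ²-expand ⟩
    1ᶜ +ᶜ h *ᶜ h *ᶜ (1ᶜ +ᶜ 2ᶜ *ᶜ s +ᶜ ofℝ (ofℚ (fromℕ 5)))
      ≈⟨ solve 1 (λ s → con 𝟙 :+ con (½ ⊹ 0ℚ) :* con (½ ⊹ 0ℚ) :* (con 𝟙 :+ con (cast 2) :* s :+ con (cast 5))
           := con (½ ⊹ 0ℚ) :* (s :+ con (cast 5))) ≋-refl s ⟩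
    h *ᶜ (s +ᶜ ofℝ (ofℚ (fromℕ 5)))                    ≈⟨ ℂR.*-congˡ (ℂR.+-congˡ √5²) ⟨
    h *ᶜ (s +ᶜ s *ᶜ s)                                 ≈⟨ solve 2 (λ h s → h :* (s :+ s :* s) := s :* (h :* (con 𝟙 :+ s))) ≋-refl h s ⟩
    s *ᶜ (h *ᶜ (1ᶜ +ᶜ s))                              ≈⟨ ℂR.*-congˡ φ-def ⟨
    s *ᶜ f                                             ∎

-- Complex conjugation and exp (iπ)

conjℚ : ℚ[i] → ℚ[i]
conjℚ (a ⊹ b) = a ⊹ - b

conj : ℂ → ℂ
conj z = re z +i (-ʳ im z)

-- The coefficients of the series are real, so conjugation commutes with every partial sum exactly.
conj-exp : ∀ z → exp (conj z) ≋ conj (exp z)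
conj-exp z = pointwise λ n → conj-expℚ n (approx z n)
  where
  open +-*-Solver
  conj-⊕ : ∀ x y → conjℚ (x ⊕ y) ≡ conjℚ x ⊕ conjℚ y
  conj-⊕ (a ⊹ b) (c ⊹ d) = cong ((a + c) ⊹_) (neg-distrib-+ b d)
  conj-⊗ : ∀ x y → conjℚ (x ⊗ y) ≡ conjℚ x ⊗ conjℚ y
  conj-⊗ (a ⊹ b) (c ⊹ d) = cong₂ _⊹_
    (solve 4 (λ a b c d → a :* c :- b :* d := a :* c :- (:- b) :* (:- d)) refl a b c d)
    (solve 4 (λ a b c d → :- (a :* d :+ b :* c) := a :* (:- d) :+ (:- b) :* c) refl a b c d)
  conj-pow : ∀ k x → pow (conjℚ x) k ≡ conjℚ (pow x k)
  conj-pow zero    x = refl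
  conj-pow (suc k) x = trans (cong (conjℚ x ⊗_) (conj-pow k x)) (sym (conj-⊗ x (pow x k)))
  conj-expℚ : ∀ n x → expℚ n (conjℚ x) ≡ conjℚ (expℚ n x)
  conj-expℚ zero    x = refl
  conj-expℚ (suc n) x = trans
    (cong₂ (λ s t → s ⊕ (invFactorial n ⊹ 0ℚ) ⊗ t) (conj-expℚ n x) (conj-pow n x))
    (sym (trans (conj-⊕ (expℚ n x) (expTerm x n)) (cong (conjℚ (expℚ n x) ⊕_) (conj-⊗ (invFactorial n ⊹ 0ℚ) (pow x n)))))

exp-inverse : ∀ z → exp z *ᶜ exp (-ᶜ z) ≋ 1ᶜ
exp-inverse z = ≋-trans (≋-sym (exp-+ z (-ᶜ z))) (≋-trans (exp-cong (ℂR.-‿inverseʳ z)) exp-0)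

exp-iπ : ∀ {π} → IsPi π → exp (𝕚 *ᶜ ofℝ π) ≋ -ᶜ 1ᶜ
exp-iπ {π} isPi = begin
  exp (𝕚 *ᶜ ofℝ π)      ≈⟨ exp-cong (≋-trans (solve 2 (λ i p → i :* p := i :* (con (½ ⊹ 0ℚ) :* p) :+ i :* (con (½ ⊹ 0ℚ) :* p)) ≋-refl 𝕚 (ofℝ π))
                             (≋-sym (ℂR.+-cong (ℂR.*-congˡ (ofℝ-* (ofℚ ½) π)) (ℂR.*-congˡ (ofℝ-* (ofℚ ½) π))))) ⟩
  exp (x +ᶜ x)          ≈⟨ exp-+ x x ⟩
  -- The two zeros hold the places of the summands Re h in conj h = -h + 2 Re h; Re h is cos (π/2)
  -- by definition.
  h *ᶜ h                ≈⟨ solve 1 (λ h → h :* h := :- (h :* (:- h :+ (con 𝟘 :+ con 𝟘)))) ≋-refl h ⟩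
  -ᶜ (h *ᶜ (-ᶜ h +ᶜ (0ᶜ +ᶜ 0ᶜ)))
                        ≈⟨ ℂR.-‿cong (ℂR.*-congˡ (≋-trans conj-h (ℂR.+-congˡ (ℂR.+-cong cos≋0 cos≋0)))) ⟨
  -ᶜ (h *ᶜ conj h)      ≈⟨ ℂR.-‿cong (ℂR.*-congˡ (≋-trans (exp-cong conj-x) (conj-exp x))) ⟨
  -ᶜ (h *ᶜ exp (-ᶜ x))  ≈⟨ ℂR.-‿cong (exp-inverse x) ⟩
  -ᶜ 1ᶜ                 ∎
  where
  open ≈-Reasoning ℂR.setoid
  open ℂ-Solver
  module R = +-*-Solver
  x h c : ℂ
  x = 𝕚 *ᶜ ofℝ (ofℚ ½ *ʳ π)
  h = exp x
  c = ofℝ (re h)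
  cos≋0 : c ≋ 0ᶜ
  cos≋0 = ofℝ-cong (IsPi.cos[π/2] isPi)
  conj-h : conj h ≋ -ᶜ h +ᶜ (c +ᶜ c)
  conj-h = pointwise λ n → cong₂ _⊹_
    (R.solve 1 (λ a → a R.:= R.:- a R.:+ (a R.:+ a)) refl (seq (re h) n))
    (R.solve 1 (λ b → R.:- b R.:= R.:- b R.:+ (R.con 0ℚ R.:+ R.con 0ℚ)) refl (seq (im h) n))
  conj-x : -ᶜ x ≋ conj x
  conj-x = pointwise λ n → cong (_⊹ - seq (im x) n)
    (R.solve 1 (λ t → R.:- (R.con 0ℚ R.:* t R.:- R.con 1ℚ R.:* R.con 0ℚ) R.:= R.con 0ℚ R.:* t R.:- R.con 1ℚ R.:* R.con 0ℚ)
      refl (seq (ofℚ ½ *ʳ π) n))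

-- Exponential functions on ℂ

record IsExponential (E : ℂ → ℂ) : Set where
  field
    E-cong : ∀ {m n} → m ≋ n → E m ≋ E n
    E-+    : ∀ m n → E (m +ᶜ n) ≋ E m *ᶜ E n
    E-0    : E 0ᶜ ≋ 1ᶜ

  E-inverse : ∀ n → E n *ᶜ E (-ᶜ n) ≋ 1ᶜ
  E-inverse n = ≋-trans (≋-sym (E-+ n (-ᶜ n))) (≋-trans (E-cong (ℂR.-‿inverseʳ n)) E-0)

  E-pred : ∀ n → E (n -ᶜ 1ᶜ) *ᶜ E 1ᶜ ≋ E n
  E-pred n = ≋-trans (≋-sym (E-+ (n -ᶜ 1ᶜ) 1ᶜ)) (E-cong (solve 1 (λ n → (n :+ :- con 𝟙) :+ con 𝟙 := n) ≋-refl n))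
    where open ℂ-Solver

  E-neg-pred : ∀ n → E (-ᶜ (n -ᶜ 1ᶜ)) ≋ E (-ᶜ n) *ᶜ E 1ᶜ
  E-neg-pred n = ≋-trans (E-cong (solve 1 (λ n → :- (n :+ :- con 𝟙) := :- n :+ con 𝟙) ≋-refl n)) (E-+ (-ᶜ n) 1ᶜ)
    where open ℂ-Solver

exp-isExponential : ∀ c → IsExponential (λ n → exp (c *ᶜ n))
exp-isExponential c = record
  { E-cong = λ h → exp-cong (ℂR.*-congˡ h)
  ; E-+    = λ m n → ≋-trans (exp-cong (ℂR.distribˡ c m n)) (exp-+ (c *ᶜ m) (c *ᶜ n))
  ; E-0    = ≋-trans (exp-cong (ℂR.zeroʳ c)) exp-0 }

-- `φ^_` has its constant to the right of the exponent, `[-1]^_` to the left, hence the two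
-- versions.
exp-isExponentialʳ : ∀ c → IsExponential (λ n → exp (n *ᶜ c))
exp-isExponentialʳ c = record
  { E-cong = λ h → exp-cong (ℂR.*-congʳ h)
  ; E-+    = λ m n → ≋-trans (exp-cong (ℂR.distribʳ c m n)) (exp-+ (m *ᶜ c) (n *ᶜ c))
  ; E-0    = ≋-trans (exp-cong (ℂR.zeroˡ c)) exp-0 }

-- The principal sequence and its Ω form

module PrincipalSequence (π : ℝ) (isPi : IsPi π) (logφ : ℝ) (isLog : IsLog φ logφ) where
  open Powers π logφ
  open ≈-Reasoning ℂR.setoid
  open ℂ-Solver

  private
    module P = IsExponential (exp-isExponentialʳ (ofℝ logφ))
    module M = IsExponential (exp-isExponential (𝕚 *ᶜ ofℝ π))
    f s t : ℂ
    f = ofℝ φ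
    s = ofℝ √5
    t = 1ᶜ /ᶜ s [ √5#0 ]

  φ^1≋φ : φ^ 1ᶜ ≋ ofℝ φ
  φ^1≋φ = ≋-trans (exp-cong (ℂR.*-identityˡ (ofℝ logφ))) (≈⇒≋ isLog)

  [-1]^1≋-1 : [-1]^ 1ᶜ ≋ -ᶜ 1ᶜ
  [-1]^1≋-1 = ≋-trans (exp-cong (ℂR.*-identityʳ (𝕚 *ᶜ ofℝ π))) (exp-iπ isPi)

  φ^#0 : ∀ n → φ^ n #0
  φ^#0 n = invertible⇒#0 (φ^ n) (φ^ (-ᶜ n)) (P.E-inverse n)

  -- Both sides are inverse to `φ^ (n -ᶜ 1ᶜ)`. This trades the division, with its apartness evidence
  -- depending on n, for an exponential.
  Φ≋φ^ : ∀ n → Φ φ^#0 n ≋ φ^ (-ᶜ (n -ᶜ 1ᶜ))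
  Φ≋φ^ n = *ᶜ-inverse-unique (*-/ᶜ-inverse (φ^ (n -ᶜ 1ᶜ)) (φ^#0 (n -ᶜ 1ᶜ))) (P.E-inverse (n -ᶜ 1ᶜ))

  φ^-neg-pred : ∀ n → φ^ (-ᶜ (n -ᶜ 1ᶜ)) ≋ φ^ (-ᶜ n) *ᶜ f
  φ^-neg-pred n = ≋-trans (P.E-neg-pred n) (ℂR.*-congˡ φ^1≋φ)

  Φ-isCompleteNFe : IsCompleteNFe (Φ φ^#0)
  Φ-isCompleteNFe = record
    { ω-cong = λ {m} {n} m≈n → ≋⇒≈ (≋-trans (Φ≋φ^ m)
        (≋-trans (P.E-cong (ℂR.-‿cong (ℂR.+-congʳ (≈⇒≋ m≈n)))) (≋-sym (Φ≋φ^ n))))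
    ; recurrence = λ n → ≋⇒≈ (rec n) }
    where
    rec : ∀ n → Φ φ^#0 n ≋ Φ φ^#0 (n -ᶜ 2ᶜ) -ᶜ Φ φ^#0 (n -ᶜ 1ᶜ)
    rec n = begin
      Φ φ^#0 n                              ≈⟨ Φ≋φ^ n ⟩
      -- With q = Φ n, the two earlier values are Φ (n - 1) = qφ and Φ (n - 2) = qφ².
      q                                     ≈⟨ solve 2 (λ q f → q := q :* (f :+ con 𝟙) :+ :- (q :* f)) ≋-refl q f ⟩
      q *ᶜ (f +ᶜ 1ᶜ) -ᶜ q *ᶜ f              ≈⟨ ℂR.+-congʳ (ℂR.*-congˡ φ²≋φ+1) ⟨
      q *ᶜ (f *ᶜ f) -ᶜ q *ᶜ f               ≈⟨ ℂR.+-congʳ (ℂR.*-assoc q f f) ⟨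
      q *ᶜ f *ᶜ f -ᶜ q *ᶜ f                 ≈⟨ ℂR.+-cong (≋-trans (φ^-neg-pred (n -ᶜ 1ᶜ -ᶜ 1ᶜ))
                                                 (ℂR.*-congʳ (φ^-neg-pred (n -ᶜ 1ᶜ))))
                                                 (ℂR.-‿cong (φ^-neg-pred (n -ᶜ 1ᶜ))) ⟨
      φ^ (-ᶜ (n -ᶜ 1ᶜ -ᶜ 1ᶜ -ᶜ 1ᶜ)) -ᶜ φ^ (-ᶜ (n -ᶜ 1ᶜ -ᶜ 1ᶜ))
        ≈⟨ ℂR.+-congʳ (P.E-cong (solve 1 (λ n → :- (n :+ :- con 𝟙 :+ :- con 𝟙 :+ :- con 𝟙) := :- (n :+ :- con (cast 2) :+ :- con 𝟙)) ≋-refl n)) ⟩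
      φ^ (-ᶜ (n -ᶜ 2ᶜ -ᶜ 1ᶜ)) -ᶜ φ^ (-ᶜ (n -ᶜ 1ᶜ -ᶜ 1ᶜ))
        ≈⟨ ℂR.+-cong (Φ≋φ^ (n -ᶜ 2ᶜ)) (ℂR.-‿cong (Φ≋φ^ (n -ᶜ 1ᶜ))) ⟨
      Φ φ^#0 (n -ᶜ 2ᶜ) -ᶜ Φ φ^#0 (n -ᶜ 1ᶜ)  ∎
      where
      q : ℂ
      q = φ^ (-ᶜ (n -ᶜ 1ᶜ))

  /√5 : ∀ z → z /ᶜ s [ √5#0 ] ≋ z *ᶜ t
  /√5 z = ℂR.*-congˡ (≋-sym (ℂR.*-identityˡ _))

  Ω≋Φ : ∀ n → Ω 1ᶜ 1ᶜ n ≋ Φ φ^#0 n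
  Ω≋Φ n = begin
    Ω 1ᶜ 1ᶜ n
      ≈⟨ ℂR.+-cong
           (ℂR.*-cong (ℂR.*-congˡ a₁≋-a) (/√5 (p -ᶜ a′ *ᶜ q)))
           (ℂR.*-congʳ (ℂR.*-congˡ (≋-trans (/√5 (p₁ -ᶜ [-φ]^ (-ᶜ (n -ᶜ 1ᶜ))))
             (ℂR.*-congʳ (ℂR.+-congˡ (ℂR.-‿cong (ℂR.*-cong
               (≋-trans (M.E-neg-pred n) (ℂR.*-congˡ [-1]^1≋-1)) (φ^-neg-pred n)))))))) ⟩
    1ᶜ *ᶜ (-ᶜ a) *ᶜ ((p -ᶜ a′ *ᶜ q) *ᶜ t) +ᶜ 1ᶜ *ᶜ a *ᶜ ((p₁ -ᶜ (a′ *ᶜ (-ᶜ 1ᶜ)) *ᶜ (q *ᶜ f)) *ᶜ t) *ᶜ f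
      -- The first group vanishes because φⁿ⁻¹φ = φⁿ. In the second, a a′ = 1 is the inverse law for
      -- `[-1]^_`; for complex n the factor (-1)ⁿ need not be ±1.
      ≈⟨ solve 7 (λ a a′ p p₁ q f t →
           con 𝟙 :* (:- a) :* ((p :+ :- (a′ :* q)) :* t) :+ con 𝟙 :* a :* ((p₁ :+ :- ((a′ :* (:- con 𝟙)) :* (q :* f))) :* t) :* f
             := t :* a :* (p₁ :* f :+ :- p) :+ (a :* a′) :* (t :* q :* (con 𝟙 :+ f :* f))) ≋-refl a a′ p p₁ q f t ⟩
    t *ᶜ a *ᶜ (p₁ *ᶜ f -ᶜ p) +ᶜ (a *ᶜ a′) *ᶜ (t *ᶜ q *ᶜ (1ᶜ +ᶜ f *ᶜ f))
      ≈⟨ ℂR.+-cong (ℂR.*-congˡ (ℂR.+-congʳ p₁f≋p)) (ℂR.*-cong (M.E-inverse n) (ℂR.*-congˡ 1+φ²≋√5φ)) ⟩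
    t *ᶜ a *ᶜ (p -ᶜ p) +ᶜ 1ᶜ *ᶜ (t *ᶜ q *ᶜ (s *ᶜ f))
      ≈⟨ solve 6 (λ a p q f s t → t :* a :* (p :+ :- p) :+ con 𝟙 :* (t :* q :* (s :* f)) := (s :* t) :* (q :* f)) ≋-refl a p q f s t ⟩
    (s *ᶜ t) *ᶜ (q *ᶜ f)
      ≈⟨ ℂR.*-congʳ (*-/ᶜ-inverse s √5#0) ⟩
    1ᶜ *ᶜ (q *ᶜ f)
      ≈⟨ ℂR.*-identityˡ (q *ᶜ f) ⟩
    q *ᶜ f
      ≈⟨ φ^-neg-pred n ⟨
    φ^ (-ᶜ (n -ᶜ 1ᶜ))
      ≈⟨ Φ≋φ^ n ⟨
    Φ φ^#0 n ∎
    where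
    a a′ p p₁ q : ℂ
    a  = [-1]^ n
    a′ = [-1]^ (-ᶜ n)
    p  = φ^ n
    p₁ = φ^ (n -ᶜ 1ᶜ)
    q  = φ^ (-ᶜ n)
    p₁f≋p : p₁ *ᶜ f ≋ p
    p₁f≋p = ≋-trans (ℂR.*-congˡ (≋-sym φ^1≋φ)) (P.E-pred n)
    a₁≋-a : [-1]^ (n -ᶜ 1ᶜ) ≋ -ᶜ a
    a₁≋-a = begin
      [-1]^ (n -ᶜ 1ᶜ)                          ≈⟨ solve 1 (λ x → x := :- (x :* (:- con 𝟙))) ≋-refl ([-1]^ (n -ᶜ 1ᶜ)) ⟩
      -ᶜ ([-1]^ (n -ᶜ 1ᶜ) *ᶜ (-ᶜ 1ᶜ))          ≈⟨ ℂR.-‿cong (ℂR.*-congˡ [-1]^1≋-1) ⟨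
      -ᶜ ([-1]^ (n -ᶜ 1ᶜ) *ᶜ [-1]^ 1ᶜ)         ≈⟨ ℂR.-‿cong (M.E-pred n) ⟩
      -ᶜ a                                     ∎

theorem4p2 : (π : ℝ) → IsPi π → (logφ : ℝ) → IsLog φ logφ →
    let open Powers π logφ in
    Σ[ φ^#0 ∈ (∀ n → φ^ n #0) ]
      IsCompleteNFe (Φ φ^#0) × (∀ n → Ω 1ᶜ 1ᶜ n ≈ Φ φ^#0 n)
theorem4p2 π isPi logφ isLog = φ^#0 , Φ-isCompleteNFe , λ n → ≋⇒≈ (Ω≋Φ n)
  where open PrincipalSequence π isPi logφ isLog
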